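{- Let $\sigma^{**}(N)$ denote the sum of the biunitary divisors of a positive integer $N$. A positive integer $N$ satisfies $\sigma^{**}(\sigma^{**}(N))=2N$ if and only if $N=2$ or $N=9$.
   Context: A divisor $d$ of $N$ is a unitary divisor if $\gcd(d,N/d)=1$. A divisor $d$ of a positive integer $N$ is a biunitary divisor if the greatest common unitary divisor of $d$ and $N/d$ is $1$. $\sigma^{**}(N)$ is the sum of all biunitary divisors of $N$. Equivalently, $\sigma^{**}$ is multiplicative and for a prime $p$ and positive integer $e$: $\sigma^{**}(p^e)=\frac{p^{e+1}-1}{p-1}$ if $e$ is odd, and $\sigma^{**}(p^e)=\frac{p^{e+1}-1}{p-1}-p^{e/2}$ if $e$ is even. -}

module Defs where

open import Data.Nat using (ℕ; zero; suc; _+_; _≡ᵇ_)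
open import Data.Nat.Divisibility using (_∣?_)
open import Data.Nat.GCD using (gcd)
open import Data.Nat.DivMod using (_/_)
open import Data.List using (List; []; _∷_; filterᵇ; upTo; map)
open import Data.Nat.ListAction using (sum)
open import Data.Bool using (Bool; true; false; _∧_; _∨_; not; if_then_else_)
open import Relation.Nullary.Decidable using (⌊_⌋)

allᵇ : (ℕ → Bool) → List ℕ → Bool
allᵇ p [] = true
allᵇ p (x ∷ xs) = p x ∧ allᵇ p xs

range1 : ℕ → List ℕ
range1 n = map suc (upTo n)

divides : ℕ → ℕ → Bool
divides d m = ⌊ d ∣? m ⌋

-- integer quotient m / d (d ≥ 1); 0 when d = 0 (never used with d = 0)
quot : ℕ → ℕ → ℕ
quot m zero = zero
quot m (suc d) = m / suc d

isUnitaryDivisor : ℕ → ℕ → Bool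
isUnitaryDivisor k m = divides k m ∧ (gcd k (quot m k) ≡ᵇ 1)

-- the greatest common unitary divisor of a and b is 1 :
-- no common unitary divisor k > 1 (all positive common unitary divisors
-- are bounded by a, since a ≥ 1 here)
gcudIsOne : ℕ → ℕ → Bool
gcudIsOne a b =
  allᵇ (λ k → (k ≡ᵇ 1) ∨ not (isUnitaryDivisor k a ∧ isUnitaryDivisor k b)) (range1 a)

isBiunitaryDivisor : ℕ → ℕ → Bool
isBiunitaryDivisor d N = divides d N ∧ gcudIsOne d (quot N d)

σ** : ℕ → ℕ
σ** N = sum (filterᵇ (λ d → isBiunitaryDivisor d N) (range1 N))

{-# OPTIONS --safe #-}
-- Write f = σ** and h(n) = f(n) / n, so that h(N) h(f(N)) = 2. Both f and h are multiplicative,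
-- f(p^e) is even for odd p, and h(n) ≥ 1 + 1/p for every prime p | n, unless p² ∥ n, where still
-- h(n) ≥ 1 + 1/p².
--
-- If N and f(N) are both even, then h(2^a) ≥ 27/16 for a ≥ 3 forces their 2-parts to be (2, 4),
-- (4, 2) or (4, 4), where the primes 3, respectively 5, 13, 17 and 29, lead to a contradiction.
-- If f(N) is odd, then N is a power of 2, and f(N) = t (t + 2) or t (2t + 3) as below.
-- If N is odd, then 4 ∤ f(f(N)), so f(N) = 2^a M with M = 1 or a power of a prime q. Apart from
-- a = 1, which gives N = 9, and a = 2, put t = 2^k - 1. For a = 2k - 1 the product t (t + 2)
-- divides 2N, and a prime divisor of t makes h(N) too large. For a = 2k the product t (2t + 3)
-- divides 2N; the bound on h(N) then forces t and w = 2t + 3 to be primes dividing N exactly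
-- twice, so (t² + 1)/2 and (w² + 1)/2 are both powers of q, and the smaller would divide the larger.
module Submission where

open import Defs
open import Data.Nat using (ℕ; _*_; _≥_)
open import Data.Sum using (_⊎_)
open import Relation.Binary.PropositionalEquality using (_≡_)
open import Function.Bundles using (_⇔_)
open import Data.Bool using (Bool; true; false; T; _∧_; _∨_; not)
open import Data.Bool.Properties using (T-∧; T-∨; T-not-≡; T-≡)
open import Data.Empty using (⊥; ⊥-elim)
open import Data.List using (List; []; _∷_; _++_; filterᵇ; map; upTo; applyUpTo; cartesianProductWith)
open import Data.List.Properties using (map-++; map-applyUpTo)
open import Data.List.Membership.Propositional using (_∈_)
open import Data.List.Membership.Propositional.Properties
  using (∈-filter⁺; ∈-filter⁻; ∈-map⁺; ∈-map⁻; ∈-upTo⁺; ∈-upTo⁻; ∈-++⁺ˡ; ∈-++⁺ʳ; ∈-++⁻;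
         ∈-cartesianProductWith⁺; ∈-cartesianProductWith⁻)
open import Data.List.Membership.Propositional.Properties.WithK using (unique∧set⇒bag)
open import Data.List.Relation.Binary.BagAndSetEquality using (∼bag⇒↭)
open import Data.List.Relation.Unary.All using (All; []; _∷_)
import Data.List.Relation.Unary.All as All
import Data.List.Relation.Unary.All.Properties as All
open import Data.List.Relation.Unary.AllPairs using ([]; _∷_)
open import Data.List.Relation.Unary.Any using (here; there)
open import Data.List.Relation.Unary.Unique.Propositional using (Unique)
import Data.List.Relation.Unary.Unique.Propositional.Properties as Uniq
open import Data.Nat
open import Data.Nat.Coprimality using (Coprime; coprime-divisor; gcd≡1⇒coprime; coprime⇒gcd≡1)
import Data.Nat.Coprimality as Coprimality
open import Data.Nat.Divisibility renaming (divides to divides-by)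
open import Data.Nat.DivMod using (_/_; m*n/n≡m)
open import Data.Nat.GCD using (gcd; mkGCD; module GCD)
open import Data.Nat.Induction using (<-rec)
open import Data.Nat.ListAction using (sum)
open import Data.Nat.ListAction.Properties using (sum-↭; sum-++)
open import Data.Nat.Primality
open import Data.Nat.Primality.Factorisation using (factorise)
open import Data.Nat.Properties
open import Data.Nat.Tactic.RingSolver using (solve-∀)
open import Data.Product using (∃; ∃₂; _×_; _,_; proj₁; proj₂)
open import Data.Sum using (inj₁; inj₂; [_,_]′)
open import Function using (id; _∘_)
open import Function.Bundles using (mk⇔; module Equivalence)
open import Relation.Binary.Definitions using (tri<; tri≈; tri>)
open import Relation.Binary.PropositionalEquality
open import Relation.Nullary using (¬_; yes; no; contradiction)
open import Relation.Nullary.Decidable using (True; toSum; toWitness; fromWitness; from-no; from-yes)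

open Equivalence using (to; from)


-- The equation has two faces. Prime divisors of f(N) and of f(f(N)) = 2N move from one number to
-- the other, and every prime that arrives pushes h up. For odd N with f(N) = C M, C = 2^a, the
-- relation h(N) h(C) h(M) = 2 and h(M) ≥ 1 give h(N) ≤ 2 / h(C). This is 1 + 1/(t (t + 2)) or 1 +
-- (t + 2)/(t (2t + 3)), too close to 1 for most primes of the odd number f(C), all of which divide
-- N. For t = 1 no prime divides t and the method says nothing, so the exponents a = 1 and a = 2
-- need arithmetic with the primes 3, 5 and 13. At the end of the case a = 2k, with t = 2g + 1, the
-- two halves D = (t² + 1)/2 and E = (w² + 1)/2 satisfy E = 4 D + (9 + 12 g). The quadratic D
-- exceeds this remainder from g = 6 on, and five values of g are left to check. Neither fractions
-- nor subtraction occur: h(n) ≥ a/b is written `a * n ≤ b * f n`, and p - 1 is `r` with p = 1 + r.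

-- Unitary and biunitary divisors as types, matched with the Boolean tests

record UnitaryDivisor (k n : ℕ) : Set where
  constructor unitary
  field
    cofactor : ℕ
    factors  : n ≡ k * cofactor
    coprime  : Coprime k cofactor

NoCommonUnitary : ℕ → ℕ → Set
NoCommonUnitary a b = ∀ {k} → UnitaryDivisor k a → UnitaryDivisor k b → k ≡ 1

record BiunitaryDivisor (d n : ℕ) : Set where
  constructor biunitary
  field
    cofactor : ℕ
    factors  : n ≡ d * cofactor
    gcud≡1   : NoCommonUnitary d cofactor

allᵇ-All : ∀ p xs → T (allᵇ p xs) ⇔ All (T ∘ p) xs
allᵇ-All p []       = mk⇔ (λ _ → []) (λ _ → _)
allᵇ-All p (x ∷ xs) = mk⇔
  (λ t → let px , pxs = to T-∧ t in px ∷ to (allᵇ-All p xs) pxs)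
  (λ { (px ∷ pxs) → from T-∧ (px , from (allᵇ-All p xs) pxs) })

∈-range1⁺ : ∀ {d n} → 1 ≤ d → d ≤ n → d ∈ range1 n
∈-range1⁺ {suc d} _ d<n = ∈-map⁺ suc (∈-upTo⁺ d<n)

range1-unique : ∀ n → Unique (range1 n)
range1-unique n = Uniq.map⁺ suc-injective (Uniq.upTo⁺ n)

quot-* : ∀ k c → 1 ≤ k → quot (k * c) k ≡ c
quot-* (suc k) c _ = trans (cong (_/ suc k) (*-comm (suc k) c)) (m*n/n≡m c (suc k))

factor-positive : ∀ {n} m {o} → 1 ≤ n → n ≡ m * o → 1 ≤ m
factor-positive zero    1≤n refl = 1≤n
factor-positive (suc m) _   _    = s≤s z≤n

cofactor-positive : ∀ {n} m {o} → 1 ≤ n → n ≡ m * o → 1 ≤ o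
cofactor-positive m {o} 1≤n eq = factor-positive o 1≤n (trans eq (*-comm m o))

factor-≤ : ∀ {n} m {o} → 1 ≤ n → n ≡ m * o → m ≤ n
factor-≤ m {o} 1≤n eq = ∣⇒≤ {{>-nonZero 1≤n}} (subst (m ∣_) (sym eq) (m∣m*n o))

dividesT : ∀ {d n} → T (divides d n) ⇔ d ∣ n
dividesT = mk⇔ toWitness fromWitness

unitaryT⁺ : ∀ {k n} → 1 ≤ n → UnitaryDivisor k n → T (isUnitaryDivisor k n)
unitaryT⁺ {k} 1≤n (unitary c refl k⊥c) = from T-∧
  ( from (dividesT {k}) (m∣m*n c)
  , subst (λ q → T (gcd k q ≡ᵇ 1)) (sym (quot-* k c (factor-positive k 1≤n refl)))
      (≡⇒≡ᵇ _ _ (coprime⇒gcd≡1 k⊥c)) )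

unitaryT⁻ : ∀ {k n} → 1 ≤ n → T (isUnitaryDivisor k n) → UnitaryDivisor k n
unitaryT⁻ {k} 1≤n t with to T-∧ t
... | k∣n , g with to (dividesT {k}) k∣n
... | divides-refl c = unitary c (*-comm c k) (gcd≡1⇒coprime (≡ᵇ⇒≡ _ _
        (subst (λ q → T (gcd k q ≡ᵇ 1))
          (trans (cong (λ n → quot n k) (*-comm c k))
                 (quot-* k c (factor-positive k 1≤n (*-comm c k)))) g)))

gcudT : ∀ {a b} → 1 ≤ a → 1 ≤ b → T (gcudIsOne a b) ⇔ NoCommonUnitary a b
gcudT {a} {b} 1≤a 1≤b = mk⇔ ⇒ ⇐
  where
  test : ℕ → Bool
  test k = (k ≡ᵇ 1) ∨ not (isUnitaryDivisor k a ∧ isUnitaryDivisor k b)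
  ⇒ : T (gcudIsOne a b) → NoCommonUnitary a b
  ⇒ t {k} ka@(unitary c eq _) kb with to T-∨ (All.lookup (to (allᵇ-All test (range1 a)) t)
                     (∈-range1⁺ (factor-positive k 1≤a eq) (factor-≤ k 1≤a eq)))
  ... | inj₁ k≡1  = ≡ᵇ⇒≡ k 1 k≡1
  ... | inj₂ none = ⊥-elim (subst T (to T-not-≡ none) (from T-∧ (unitaryT⁺ 1≤a ka , unitaryT⁺ 1≤b kb)))
  test-true : NoCommonUnitary a b → ∀ k → T (test k)
  test-true h k with isUnitaryDivisor k a in ka | isUnitaryDivisor k b in kb
  ... | false | _     = from (T-∨ {k ≡ᵇ 1}) (inj₂ _)
  ... | true  | false = from (T-∨ {k ≡ᵇ 1}) (inj₂ _)
  ... | true  | true  = from (T-∨ {k ≡ᵇ 1}) (inj₁ (≡⇒≡ᵇ k 1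
          (h (unitaryT⁻ 1≤a (from T-≡ ka)) (unitaryT⁻ 1≤b (from T-≡ kb)))))
  ⇐ : NoCommonUnitary a b → T (gcudIsOne a b)
  ⇐ h = from (allᵇ-All test (range1 a)) (All.tabulate λ {k} _ → test-true h k)

biunitaryT : ∀ {d n} → 1 ≤ n → T (isBiunitaryDivisor d n) ⇔ BiunitaryDivisor d n
biunitaryT {d} {n} 1≤n = mk⇔ ⇒ ⇐
  where
  ⇒ : T (isBiunitaryDivisor d n) → BiunitaryDivisor d n
  ⇒ t with to T-∧ t
  ... | d∣n , g with to (dividesT {d}) d∣n
  ... | divides-refl c = biunitary c (*-comm c d)
    (to (gcudT 1≤d (factor-positive c {d} 1≤n refl))
      (subst (T ∘ gcudIsOne d) (trans (cong (λ n → quot n d) (*-comm c d)) (quot-* d c 1≤d)) g))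
    where 1≤d = factor-positive d 1≤n (*-comm c d)
  ⇐ : BiunitaryDivisor d n → T (isBiunitaryDivisor d n)
  ⇐ (biunitary c refl h) = from T-∧
    ( from (dividesT {d}) (m∣m*n c)
    , subst (T ∘ gcudIsOne d) (sym (quot-* d c 1≤d)) (from (gcudT 1≤d (cofactor-positive d 1≤n refl)) h) )
    where 1≤d = factor-positive d 1≤n refl

biunitaryDivisors : ℕ → List ℕ
biunitaryDivisors n = filterᵇ (λ d → isBiunitaryDivisor d n) (range1 n)

biunitaryDivisors-unique : ∀ n → Unique (biunitaryDivisors n)
biunitaryDivisors-unique n = Uniq.filter⁺ _ (range1-unique n)

∈-biunitaryDivisors : ∀ {d n} → 1 ≤ n → d ∈ biunitaryDivisors n ⇔ BiunitaryDivisor d n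
∈-biunitaryDivisors {d} {n} 1≤n = mk⇔
  (λ d∈ → to (biunitaryT 1≤n) (proj₂ (∈-filter⁻ _ {xs = range1 n} d∈)))
  (λ bd → let open BiunitaryDivisor bd in
     ∈-filter⁺ _ (∈-range1⁺ (factor-positive d 1≤n factors) (factor-≤ d 1≤n factors))
       (from (biunitaryT 1≤n) bd))

-- Two duplicate-free lists with the same members are permutations of each other, so `σ**` may be
-- computed from any convenient enumeration: products of divisors for multiplicativity, a list of
-- powers for prime powers.
σ**-enumerated : ∀ {n} xs → 1 ≤ n → Unique xs → (∀ {d} → d ∈ xs ⇔ BiunitaryDivisor d n) →
                 σ** n ≡ sum xs
σ**-enumerated {n} xs 1≤n xs! xs⇔ = sum-↭ (∼bag⇒↭ (unique∧set⇒bag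
  (biunitaryDivisors-unique n) xs!
  (mk⇔ (λ d∈ → from xs⇔ (to (∈-biunitaryDivisors 1≤n) d∈))
       (λ d∈ → from (∈-biunitaryDivisors 1≤n) (to xs⇔ d∈)))))

-- Multiplicativity

coprime-∣ : ∀ {m n a b} → Coprime m n → a ∣ m → b ∣ n → Coprime a b
coprime-∣ m⊥n a∣m b∣n (i∣a , i∣b) = m⊥n (∣-trans i∣a a∣m , ∣-trans i∣b b∣n)

coprime-* : ∀ {k m n} → Coprime k m → Coprime k n → Coprime k (m * n)
coprime-* k⊥m k⊥n (i∣k , i∣mn) =
  k⊥n (i∣k , coprime-divisor (λ (j∣i , j∣m) → k⊥m (∣-trans j∣i i∣k , j∣m)) i∣mn)


reduced : ∀ m n → 1 ≤ n → ∃ λ g → ∃₂ λ x y → m ≡ g * x × n ≡ g * y × Coprime x y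
reduced m n 1≤n with mkGCD m n
... | g , G with GCD.commonDivisor G
... | divides-refl x , divides-refl y =
  g , x , y , *-comm x g , *-comm y g , λ {i} (i∣x , i∣y) →
    ∣1⇒≡1 (*-cancelʳ-∣ g {{>-nonZero (cofactor-positive y 1≤n refl)}}
      (subst (i * g ∣_) (sym (*-identityˡ g)) (GCD.greatest G (*-monoˡ-∣ g i∣x , *-monoˡ-∣ g i∣y))))

-- Writing m n = d e as a 2 × 2 array of factors.
refine : ∀ {m n d e} → 1 ≤ m → 1 ≤ d → m * n ≡ d * e →
         ∃₂ λ a b → ∃₂ λ a′ b′ → d ≡ a * b × e ≡ a′ * b′ × m ≡ a * a′ × n ≡ b * b′
refine {m} {n} {d} {e} 1≤m 1≤d eq with reduced d m 1≤m
... | a , b , a′ , refl , refl , b⊥a′ with coprime-divisor b⊥a′ (divides-by e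
        (*-cancelˡ-≡ (a′ * n) (e * b) a {{a≢0}} (trans (sym (*-assoc a a′ n)) (trans eq (shuffle a b e)))))
  where
  a≢0 = >-nonZero (factor-positive a 1≤m refl)
  shuffle : ∀ a b e → a * b * e ≡ a * (e * b)
  shuffle = solve-∀
... | divides-refl b′ = a , b , a′ , b′ , refl , e≡ , refl , *-comm b′ b
  where
  shuffle : ∀ a a′ b b′ → a * a′ * (b′ * b) ≡ a * b * (a′ * b′)
  shuffle = solve-∀
  e≡ : e ≡ a′ * b′
  e≡ = *-cancelˡ-≡ e (a′ * b′) (a * b) {{>-nonZero 1≤d}} (trans (sym eq) (shuffle a a′ b b′))

unitary-extend : ∀ {k a} b → Coprime a b → UnitaryDivisor k a → UnitaryDivisor k (a * b)
unitary-extend {k} b a⊥b (unitary c refl k⊥c) =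
  unitary (c * b) (*-assoc k c b) (coprime-* k⊥c (coprime-∣ a⊥b (m∣m*n c) ∣-refl))

split-unitary : ∀ {k m n} → 1 ≤ k → 1 ≤ m → UnitaryDivisor k (m * n) →
                ∃₂ λ a b → k ≡ a * b × UnitaryDivisor a m × UnitaryDivisor b n
split-unitary {k} 1≤k 1≤m (unitary c eq k⊥c) with refine 1≤m 1≤k eq
... | a , b , a′ , b′ , refl , refl , refl , refl =
  a , b , refl , unitary a′ refl (coprime-∣ k⊥c (m∣m*n b) (m∣m*n b′))
               , unitary b′ refl (coprime-∣ k⊥c (n∣m*n a) (n∣m*n a′))

-- `a` divides `a′ * b′` and is coprime to `b′`, hence divides `a′`; four such divisibilities give
-- both equalities by antisymmetry.
split-unique : ∀ {m n a b a′ b′} → Coprime m n → a ∣ m → b ∣ n → a′ ∣ m → b′ ∣ n →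
               a * b ≡ a′ * b′ → a ≡ a′ × b ≡ b′
split-unique {m} {n} {a} {b} {a′} {b′} m⊥n a∣m b∣n a′∣m b′∣n eq =
    ∣-antisym (left  a∣m  b′∣n (subst (a  ∣_) eq       (m∣m*n b)))
              (left  a′∣m b∣n  (subst (a′ ∣_) (sym eq) (m∣m*n b′)))
  , ∣-antisym (right b∣n  a′∣m (subst (b  ∣_) eq       (n∣m*n a)))
              (right b′∣n a∣m  (subst (b′ ∣_) (sym eq) (n∣m*n a′)))
  where
  left : ∀ {x y w} → x ∣ m → y ∣ n → x ∣ w * y → x ∣ w
  left {x} {y} {w} x∣m y∣n x∣wy =
    coprime-divisor (coprime-∣ m⊥n x∣m y∣n) (subst (x ∣_) (*-comm w y) x∣wy)
  right : ∀ {x y w} → x ∣ n → w ∣ m → x ∣ w * y → x ∣ y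
  right x∣n w∣m = coprime-divisor (Coprimality.sym (coprime-∣ m⊥n w∣m x∣n))

-- A unitary divisor of one of two coprime numbers stays unitary in their product, so a common
-- unitary divisor on the side of `m`, or of `n`, is one of the whole pair.
split-biunitary : ∀ {m n d} → 1 ≤ m → 1 ≤ n → Coprime m n → BiunitaryDivisor d (m * n) →
                  ∃₂ λ a b → d ≡ a * b × BiunitaryDivisor a m × BiunitaryDivisor b n
split-biunitary {d = d} 1≤m 1≤n m⊥n (biunitary c eq h)
  with refine 1≤m (factor-positive d (*-mono-≤ 1≤m 1≤n) eq) eq
... | a , b , a′ , b′ , refl , refl , refl , refl =
  a , b , refl
  , biunitary a′ refl (λ ka ka′ → h
      (unitary-extend b (coprime-∣ m⊥n (m∣m*n a′) (m∣m*n b′)) ka)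
      (unitary-extend b′ (coprime-∣ m⊥n (n∣m*n a) (n∣m*n b)) ka′))
  , biunitary b′ refl (λ kb kb′ → h
      (subst (UnitaryDivisor _) (*-comm b a)
        (unitary-extend a (Coprimality.sym (coprime-∣ m⊥n (m∣m*n a′) (m∣m*n b′))) kb))
      (subst (UnitaryDivisor _) (*-comm b′ a′)
        (unitary-extend a′ (Coprimality.sym (coprime-∣ m⊥n (n∣m*n a) (n∣m*n b))) kb′)))

-- A common unitary divisor of `a * b` and `a′ * b′` splits along `m` and `n` in two ways.
-- Uniqueness identifies the splittings, so each half is common to `a` and `a′`, or to `b` and `b′`,
-- and equals 1.
biunitary-* : ∀ {m n a b} → 1 ≤ m → 1 ≤ n → Coprime m n →
              BiunitaryDivisor a m → BiunitaryDivisor b n → BiunitaryDivisor (a * b) (m * n)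
biunitary-* {a = a} {b} 1≤m 1≤n m⊥n (biunitary a′ refl ha) (biunitary b′ refl hb) =
  biunitary (a′ * b′) (shuffle a a′ b b′) none
  where
  shuffle : ∀ a a′ b b′ → a * a′ * (b * b′) ≡ a * b * (a′ * b′)
  shuffle = solve-∀
  1≤a = factor-positive a 1≤m refl
  1≤b = factor-positive b 1≤n refl
  1≤a′ = cofactor-positive a 1≤m refl
  none : NoCommonUnitary (a * b) (a′ * b′)
  none {k} u@(unitary c eq _) u′
    with split-unitary (factor-positive k (*-mono-≤ 1≤a 1≤b) eq) 1≤a u
       | split-unitary (factor-positive k (*-mono-≤ 1≤a 1≤b) eq) 1≤a′ u′
  ... | x , y , refl , xa , yb | x′ , y′ , xy≡x′y′ , x′a′ , y′b′
    with split-unique m⊥n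
           (∣-trans (unitary-∣ xa) (m∣m*n a′)) (∣-trans (unitary-∣ yb) (m∣m*n b′))
           (∣-trans (unitary-∣ x′a′) (n∣m*n a)) (∣-trans (unitary-∣ y′b′) (n∣m*n b)) xy≡x′y′
    where
    unitary-∣ : ∀ {k n} → UnitaryDivisor k n → k ∣ n
    unitary-∣ (unitary c refl _) = m∣m*n c
  ... | refl , refl = cong₂ _*_ (ha xa x′a′) (hb yb y′b′)

biunitary-∣ : ∀ {d n} → BiunitaryDivisor d n → d ∣ n
biunitary-∣ (biunitary c refl _) = m∣m*n c

sum-map-* : ∀ x ys → sum (map (x *_) ys) ≡ x * sum ys
sum-map-* x []       = sym (*-zeroʳ x)
sum-map-* x (y ∷ ys) = trans (cong (x * y +_) (sum-map-* x ys)) (sym (*-distribˡ-+ x y (sum ys)))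

sum-cartesianProductWith-* : ∀ xs ys → sum (cartesianProductWith _*_ xs ys) ≡ sum xs * sum ys
sum-cartesianProductWith-* []       ys = refl
sum-cartesianProductWith-* (x ∷ xs) ys = begin
  sum (map (x *_) ys ++ cartesianProductWith _*_ xs ys)
    ≡⟨ sum-++ (map (x *_) ys) _ ⟩
  sum (map (x *_) ys) + sum (cartesianProductWith _*_ xs ys)
    ≡⟨ cong₂ _+_ (sum-map-* x ys) (sum-cartesianProductWith-* xs ys) ⟩
  x * sum ys + sum xs * sum ys
    ≡⟨ *-distribʳ-+ (sum ys) x (sum xs) ⟨
  (x + sum xs) * sum ys ∎
  where open ≡-Reasoning

-- Injectivity is asked on members only: multiplication is injective on pairs of divisors of two
-- coprime numbers, not on all pairs.
cartesianProductWith-unique : ∀ {A B C : Set} (f : A → B → C) {xs ys} →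
  (∀ {a b a′ b′} → a ∈ xs → b ∈ ys → a′ ∈ xs → b′ ∈ ys → f a b ≡ f a′ b′ → a ≡ a′ × b ≡ b′) →
  Unique xs → Unique ys → Unique (cartesianProductWith f xs ys)
cartesianProductWith-unique f {[]}          inj []         ys! = []
cartesianProductWith-unique f {x ∷ xs} {ys} inj (x∉ ∷ xs!) ys! = Uniq.++⁺
  (row ys (λ y∈ → y∈) ys!)
  (cartesianProductWith-unique f
    (λ a∈ b∈ a′∈ b′∈ → inj (there a∈) b∈ (there a′∈) b′∈) xs! ys!)
  (λ (v∈ , v∈′) → disjoint v∈ v∈′)
  where
  row : ∀ zs → (∀ {z} → z ∈ zs → z ∈ ys) → Unique zs → Unique (map (f x) zs)
  row []       sub []         = []
  row (z ∷ zs) sub (z∉ ∷ zs!) =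
    All.map⁺ (All.tabulate λ w∈ eq → All.lookup z∉ w∈
      (proj₂ (inj (here refl) (sub (here refl)) (here refl) (sub (there w∈)) eq)))
    ∷ row zs (sub ∘ there) zs!
  disjoint : ∀ {v} → v ∈ map (f x) ys → v ∈ cartesianProductWith f xs ys → ⊥
  disjoint v∈ v∈′ with ∈-map⁻ (f x) v∈ | ∈-cartesianProductWith⁻ f xs ys v∈′
  ... | y , y∈ , refl | a , b , a∈ , b∈ , eq =
    All.lookup x∉ a∈ (proj₁ (inj (here refl) y∈ (there a∈) b∈ eq))

σ**-* : ∀ {m n} → 1 ≤ m → 1 ≤ n → Coprime m n → σ** (m * n) ≡ σ** m * σ** n
σ**-* {m} {n} 1≤m 1≤n m⊥n = trans
  (σ**-enumerated products (*-mono-≤ 1≤m 1≤n) products! (mk⇔ ⇒ ⇐))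
  (sum-cartesianProductWith-* (biunitaryDivisors m) (biunitaryDivisors n))
  where
  products = cartesianProductWith _*_ (biunitaryDivisors m) (biunitaryDivisors n)
  products! : Unique products
  products! = cartesianProductWith-unique _*_
    (λ a∈ b∈ a′∈ b′∈ → split-unique m⊥n (∈-∣ 1≤m a∈) (∈-∣ 1≤n b∈) (∈-∣ 1≤m a′∈) (∈-∣ 1≤n b′∈))
    (biunitaryDivisors-unique m) (biunitaryDivisors-unique n)
    where
    ∈-∣ : ∀ {d n} → 1 ≤ n → d ∈ biunitaryDivisors n → d ∣ n
    ∈-∣ 1≤n d∈ = biunitary-∣ (to (∈-biunitaryDivisors 1≤n) d∈)
  ⇒ : ∀ {d} → d ∈ products → BiunitaryDivisor d (m * n)
  ⇒ d∈ with ∈-cartesianProductWith⁻ _*_ (biunitaryDivisors m) (biunitaryDivisors n) d∈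
  ... | a , b , a∈ , b∈ , refl = biunitary-* 1≤m 1≤n m⊥n
          (to (∈-biunitaryDivisors 1≤m) a∈) (to (∈-biunitaryDivisors 1≤n) b∈)
  ⇐ : ∀ {d} → BiunitaryDivisor d (m * n) → d ∈ products
  ⇐ bd with split-biunitary 1≤m 1≤n m⊥n bd
  ... | a , b , refl , ba , bb = ∈-cartesianProductWith⁺ _*_
          (from (∈-biunitaryDivisors 1≤m) ba) (from (∈-biunitaryDivisors 1≤n) bb)

-- Values at prime powers

prime⇒1< : ∀ {p} → Prime p → 1 < p
prime⇒1< pp = nonTrivial⇒n>1 _ {{prime⇒nonTrivial pp}}

^-injectiveʳ : ∀ {p} → 1 < p → ∀ {i j} → p ^ i ≡ p ^ j → i ≡ j
^-injectiveʳ {p} 1<p {i} {j} eq with <-cmp i j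
... | tri< i<j _ _   = contradiction eq (<⇒≢ (^-monoʳ-< p 1<p i<j))
... | tri≈ _ i≡j _   = i≡j
... | tri> _ _ j<i   = contradiction (sym eq) (<⇒≢ (^-monoʳ-< p 1<p j<i))

prime-power-factors : ∀ {p} → Prime p → ∀ e {d c} → p ^ e ≡ d * c →
                      ∃₂ λ i l → d ≡ p ^ i × c ≡ p ^ l × i + l ≡ e
prime-power-factors pp zero {d} {c} eq =
  0 , 0 , m*n≡1⇒m≡1 d c (sym eq) , m*n≡1⇒n≡1 d c (sym eq) , refl
prime-power-factors {p} pp (suc e) {d} {c} eq
  with euclidsLemma d c pp (subst (p ∣_) eq (m∣m*n (p ^ e)))
... | inj₁ (divides-refl d′) with prime-power-factors pp e {d′} {c}
        (*-cancelˡ-≡ _ _ p {{prime⇒nonZero pp}} (trans eq (shuffle d′ p c)))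
  where
  shuffle : ∀ d p c → d * p * c ≡ p * (d * c)
  shuffle = solve-∀
... | i , l , refl , refl , refl = suc i , l , *-comm d′ p , refl , refl
prime-power-factors {p} pp (suc e) {d} {c} eq
    | inj₂ (divides-refl c′) with prime-power-factors pp e {d} {c′}
        (*-cancelˡ-≡ _ _ p {{prime⇒nonZero pp}} (trans eq (shuffle d p c′)))
  where
  shuffle : ∀ d p c → d * (c * p) ≡ p * (d * c)
  shuffle = solve-∀
... | i , l , refl , refl , refl = i , suc l , refl , *-comm c′ p , +-suc i l

prime-power-unitary : ∀ {p} → Prime p → ∀ i {k} → UnitaryDivisor k (p ^ i) → k ≡ 1 ⊎ k ≡ p ^ i
prime-power-unitary {p} pp i {k} (unitary c eq k⊥c) with prime-power-factors pp i {k} {c} eq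
... | zero  , y     , refl , refl , refl = inj₁ refl
... | suc x , zero  , refl , refl , refl = inj₂ (sym (cong (p ^_) (+-identityʳ (suc x))))
... | suc x , suc y , refl , refl , refl =
  contradiction (k⊥c {p} (m∣m*n (p ^ x) , m∣m*n (p ^ y))) λ { refl → ¬prime[1] pp }

-- The only unitary divisors of a prime power are 1 and the power itself.
prime-power-noCommonUnitary : ∀ {p} → Prime p → ∀ {i l} → i ≢ l → NoCommonUnitary (p ^ i) (p ^ l)
prime-power-noCommonUnitary pp {i} {l} i≢l ki kl
  with prime-power-unitary pp i ki | prime-power-unitary pp l kl
... | inj₁ k≡1 | _         = k≡1
... | _        | inj₁ k≡1  = k≡1
... | inj₂ k≡pⁱ | inj₂ k≡pˡ = contradiction (^-injectiveʳ (prime⇒1< pp) (trans (sym k≡pⁱ) k≡pˡ)) i≢l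

-- `1 + x + ... + x ^ (n - 1)`, with `n` terms, in Horner form; for `x = 2` this is `2 ^ n - 1`.
geom : ℕ → ℕ → ℕ
geom x zero    = 0
geom x (suc n) = 1 + x * geom x n

-- The coefficient `c` is general because passing to the tail multiplies it by `x`.
sum-geometric : ∀ c x n {g : ℕ → ℕ} → (∀ i → g i ≡ c * x ^ i) → sum (applyUpTo g n) ≡ c * geom x n
sum-geometric c x zero    g≡ = sym (*-zeroʳ c)
sum-geometric c x (suc n) {g} g≡ = begin
  g 0 + sum (applyUpTo (g ∘ suc) n)
    ≡⟨ cong₂ _+_ (g≡ 0)
         (sum-geometric (c * x) x n (λ i → trans (g≡ (suc i)) (sym (*-assoc c x (x ^ i))))) ⟩
  c * 1 + c * x * geom x n
    ≡⟨ shuffle c x (geom x n) ⟩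
  c * (1 + x * geom x n) ∎
  where
  open ≡-Reasoning
  shuffle : ∀ c x s → c * 1 + c * x * s ≡ c * (1 + x * s)
  shuffle = solve-∀

-- The exponent e ≥ 1 is encoded as e = k + j with j = k + 1 (e odd) or j = k + 2 (e even):
-- the biunitary divisors of p ^ e are then the p ^ i and p ^ (j + i) with i ≤ k.
data Exponents : ℕ → ℕ → Set where
  odd-exponent  : ∀ {k} → Exponents k (1 + k)
  even-exponent : ∀ {k} → Exponents k (2 + k)

exponents : ∀ e → ∃₂ λ k j → Exponents k j × k + j ≡ suc e
exponents zero          = 0 , 1 , odd-exponent , refl
exponents (suc zero)    = 0 , 2 , even-exponent , refl
exponents (suc (suc e)) with exponents e
... | k , _ , odd-exponent  , eq = suc k , _ , odd-exponent  , cong suc (trans (+-suc k (suc k)) (cong suc eq))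
... | k , _ , even-exponent , eq = suc k , _ , even-exponent , cong suc (trans (+-suc k (suc (suc k))) (cong suc eq))

exponents-k<j : ∀ {k j} → Exponents k j → k < j
exponents-k<j odd-exponent  = ≤-refl
exponents-k<j even-exponent = n≤1+n _

-- A factorisation `p ^ i * p ^ l` fails the test only if `i = l`. The remaining exponents form the
-- blocks `0 .. k` and `j .. j + k`, and the second contributes `p ^ j` times the first.
σ**-prime-power : ∀ {p k j} → Prime p → Exponents k j →
                  σ** (p ^ (k + j)) ≡ geom p (suc k) * (1 + p ^ j)
σ**-prime-power {p} {k} {j} pp kj = trans
  (σ**-enumerated divs (m^n>0 p {{prime⇒nonZero pp}} (k + j)) divs! (mk⇔ ⇒ ⇐))
  sum-divs
  where
  1<p = prime⇒1< pp
  low  = upTo (suc k)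
  high = map (j +_) low
  divs = map (p ^_) (low ++ high)

  divs! : Unique divs
  divs! = Uniq.map⁺ (^-injectiveʳ 1<p) (Uniq.++⁺ (Uniq.upTo⁺ (suc k))
    (Uniq.map⁺ (+-cancelˡ-≡ j _ _) (Uniq.upTo⁺ (suc k))) λ (v∈ , v∈′) → disjoint v∈ v∈′)
    where
    disjoint : ∀ {v} → v ∈ low → v ∈ high → ⊥
    disjoint v∈ v∈′ with _ , _ , refl ← ∈-map⁻ (j +_) v∈′ =
      <⇒≱ (exponents-k<j kj) (≤-trans (m≤m+n j _) (s≤s⁻¹ (∈-upTo⁻ v∈)))

  divisor : ∀ {i l} → i + l ≡ k + j → i ≢ l → BiunitaryDivisor (p ^ i) (p ^ (k + j))
  divisor {i} {l} i+l i≢l = biunitary (p ^ l)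
    (trans (cong (p ^_) (sym i+l)) (^-distribˡ-+-* p i l)) (prime-power-noCommonUnitary pp i≢l)

  ⇒ : ∀ {d} → d ∈ divs → BiunitaryDivisor d (p ^ (k + j))
  ⇒ d∈ with ∈-map⁻ (p ^_) d∈
  ... | i , i∈ , refl with ∈-++⁻ low i∈
  ... | inj₁ i∈low with r , i+r ← m≤n⇒∃[o]m+o≡n (s≤s⁻¹ (∈-upTo⁻ i∈low)) =
    divisor (trans (sym (+-assoc i r j)) (cong (_+ j) i+r))
      (<⇒≢ (≤-trans (∈-upTo⁻ i∈low) (≤-trans (exponents-k<j kj) (m≤n+m j r))))
  ... | inj₂ i∈high with ∈-map⁻ (j +_) i∈high
  ... | i′ , i′∈ , refl with r , i′+r ← m≤n⇒∃[o]m+o≡n (s≤s⁻¹ (∈-upTo⁻ i′∈)) =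
    divisor (trans (+-assoc j i′ r) (trans (cong (j +_) i′+r) (+-comm j k)))
      (>⇒≢ (≤-trans (s≤s (subst (r ≤_) i′+r (m≤n+m r i′))) (≤-trans (exponents-k<j kj) (m≤m+n j i′))))

  ⇐ : ∀ {d} → BiunitaryDivisor d (p ^ (k + j)) → d ∈ divs
  ⇐ {d} (biunitary c eq h) with prime-power-factors pp (k + j) {d} {c} eq
  ... | i , l , refl , refl , i+l = ∈-map⁺ (p ^_) (place i l i+l h)
    where
    place : ∀ i l → i + l ≡ k + j → NoCommonUnitary (p ^ i) (p ^ l) → i ∈ low ++ high
    place i l i+l h with i ≤? k | j ≤? i
    ... | yes i≤k | _       = ∈-++⁺ˡ (∈-upTo⁺ (s≤s i≤k))
    ... | no _    | yes j≤i with m≤n⇒∃[o]m+o≡n j≤i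
    ... | i′ , refl = ∈-++⁺ʳ low (∈-map⁺ (j +_) (∈-upTo⁺ (s≤s (m+n≤o⇒m≤o i′ (≤-reflexive i′+l)))))
      where
      i′+l : i′ + l ≡ k
      i′+l = +-cancelˡ-≡ j _ _ (trans (sym (+-assoc j i′ l)) (trans i+l (+-comm k j)))
    place i l i+l h | no i≰k | no j≰i = ⊥-elim (middle kj (≰⇒> i≰k) (≰⇒> j≰i) i+l)
      where
      middle : ∀ {k j} → Exponents k j → k < i → i < j → i + l ≡ k + j → ⊥
      middle odd-exponent k<i i<j _ = <⇒≱ i<j k<i
      -- Only `i = l = k + 1` is left. Then `p ^ suc k`, a unitary divisor of itself, is common to
      -- both factors and would have to be 1.
      middle {k} even-exponent k<i i<j i+l with ≤-antisym (s≤s⁻¹ i<j) k<i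
      ... | refl with +-cancelˡ-≡ (suc k) l (suc k) (trans i+l (+-suc k (suc k)))
      ... | refl with m^n≡1⇒n≡0∨m≡1 p (suc k) (h whole whole)
        where
        whole : UnitaryDivisor (p ^ suc k) (p ^ suc k)
        whole = unitary 1 (sym (*-identityʳ _)) (Coprimality.sym (Coprimality.1-coprimeTo _))
      ... | inj₂ refl = ¬prime[1] pp

  sum-divs : sum divs ≡ geom p (suc k) * (1 + p ^ j)
  sum-divs = begin
    sum (map (p ^_) (low ++ high))
      ≡⟨ cong sum (map-++ (p ^_) low high) ⟩
    sum (map (p ^_) low ++ map (p ^_) high)
      ≡⟨ sum-++ (map (p ^_) low) _ ⟩
    sum (map (p ^_) low) + sum (map (p ^_) high)
      ≡⟨ cong₂ _+_ (cong sum (map-applyUpTo id (p ^_) (suc k)))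
           (cong sum (trans (cong (map (p ^_)) (map-applyUpTo id (j +_) (suc k)))
             (map-applyUpTo (j +_) (p ^_) (suc k)))) ⟩
    sum (applyUpTo (p ^_) (suc k)) + sum (applyUpTo (λ i → p ^ (j + i)) (suc k))
      ≡⟨ cong₂ _+_ (sum-geometric 1 p (suc k) (λ i → sym (*-identityˡ (p ^ i))))
           (sum-geometric (p ^ j) p (suc k) (^-distribˡ-+-* p j)) ⟩
    1 * geom p (suc k) + p ^ j * geom p (suc k)
      ≡⟨ shuffle (geom p (suc k)) (p ^ j) ⟩
    geom p (suc k) * (1 + p ^ j) ∎
    where
    open ≡-Reasoning
    shuffle : ∀ g x → 1 * g + x * g ≡ g * (1 + x)
    shuffle = solve-∀

-- Primes, parity, and bounds at a single prime

prime-divisor : ∀ {n} → 1 < n → ∃ λ p → Prime p × p ∣ n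
prime-divisor {n@(suc _)} 1<n with factorise n
... | record { factors = []    ; isFactorisation = refl } = contradiction 1<n (<-irrefl refl)
... | record { factors = p ∷ _ ; isFactorisation = eq ; factorsPrime = pp ∷ _ } =
  p , pp , subst (p ∣_) (sym eq) (m∣m*n _)

prime-∤⇒coprime : ∀ {p n} → Prime p → p ∤ n → Coprime p n
prime-∤⇒coprime pp p∤n (i∣p , i∣n) with prime⇒irreducible pp i∣p
... | inj₁ i≡1  = i≡1
... | inj₂ refl = contradiction i∣n p∤n

coprime-^ : ∀ {m n} e → Coprime m n → Coprime (m ^ e) n
coprime-^ zero    m⊥n = Coprimality.1-coprimeTo _
coprime-^ (suc e) m⊥n = Coprimality.sym (coprime-* (Coprimality.sym m⊥n) (Coprimality.sym (coprime-^ e m⊥n)))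

prime-∣-^ : ∀ {p} n e → Prime p → p ∣ n ^ e → p ∣ n
prime-∣-^ n zero    pp p∣1 with refl ← ∣1⇒≡1 p∣1 = contradiction pp ¬prime[1]
prime-∣-^ n (suc e) pp p∣nnᵉ = [ (λ p∣n → p∣n) , prime-∣-^ n e pp ]′ (euclidsLemma n (n ^ e) pp p∣nnᵉ)

prime-∣-prime : ∀ {p q} → Prime p → Prime q → p ∣ q → p ≡ q
prime-∣-prime pp pq p∣q with prime⇒irreducible pq p∣q
... | inj₁ refl = contradiction pp ¬prime[1]
... | inj₂ p≡q  = p≡q

prime-part : ∀ {p} → Prime p → ∀ n → 1 ≤ n → ∃₂ λ e m → n ≡ p ^ e * m × p ∤ m
prime-part {p} pp = <-rec _ step
  where
  step : ∀ n → (∀ {m} → m < n → 1 ≤ m → ∃₂ λ e o → m ≡ p ^ e * o × p ∤ o) →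
         1 ≤ n → ∃₂ λ e m → n ≡ p ^ e * m × p ∤ m
  step n rec 1≤n with p ∣? n
  ... | no  p∤n = 0 , n , sym (*-identityˡ n) , p∤n
  ... | yes (divides-refl c) with rec (m<m*n c p {{>-nonZero 1≤c}} (prime⇒1< pp)) 1≤c
    where 1≤c = factor-positive c 1≤n refl
  ... | e , m , refl , p∤m = suc e , m , shuffle p (p ^ e) m , p∤m
    where
    shuffle : ∀ p P m → P * m * p ≡ p * P * m
    shuffle = solve-∀

even-or-odd : ∀ n → 2 ∣ n ⊎ 2 ∣ 1 + n
even-or-odd zero    = inj₁ (2 ∣0)
even-or-odd (suc n) with even-or-odd n
... | inj₁ 2∣n   = inj₂ (∣m∣n⇒∣m+n ∣-refl 2∣n)
... | inj₂ 2∣1+n = inj₁ 2∣1+n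

odd⇒2∣1+ : ∀ {n} → 2 ∤ n → 2 ∣ 1 + n
odd⇒2∣1+ {n} 2∤n = [ (λ 2∣n → contradiction 2∣n 2∤n) , (λ 2∣1+n → 2∣1+n) ]′ (even-or-odd n)

∤⇒positive : ∀ {d n} → d ∤ n → 1 ≤ n
∤⇒positive {d} {zero}  d∤0 = contradiction (d ∣0) d∤0
∤⇒positive {d} {suc n} _   = s≤s z≤n

^≤geom : ∀ p n → p ^ n ≤ geom p (suc n)
^≤geom p zero    = s≤s z≤n
^≤geom p (suc n) = m≤n⇒m≤1+n (*-monoʳ-≤ p (^≤geom p n))

-- The two highest terms of the sum, `p ^ suc n` and `p ^ n`, already suffice.
geom-lower : ∀ p n → (1 + p) * p ^ suc n ≤ p * geom p (2 + n)
geom-lower p zero    = ≤-reflexive (eq p)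
  where
  eq : ∀ p → (1 + p) * (p * 1) ≡ p * (1 + p * (1 + p * 0))
  eq = solve-∀
geom-lower p (suc n) = begin
  (1 + p) * (p * p ^ suc n)       ≡⟨ eq p (p ^ suc n) ⟩
  p * ((1 + p) * p ^ suc n)       ≤⟨ *-monoʳ-≤ p (geom-lower p n) ⟩
  p * (p * geom p (2 + n))        ≤⟨ *-monoʳ-≤ p (n≤1+n _) ⟩
  p * (1 + p * geom p (2 + n))    ∎
  where
  open ≤-Reasoning
  eq : ∀ p x → (1 + p) * (p * x) ≡ p * ((1 + p) * x)
  eq = solve-∀

geom-closed : ∀ r n → r * geom (1 + r) n + 1 ≡ (1 + r) ^ n
geom-closed r zero    = cong (_+ 1) (*-zeroʳ r)
geom-closed r (suc n) = trans (eq r (geom (1 + r) n)) (cong ((1 + r) *_) (geom-closed r n))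
  where
  eq : ∀ r g → r * (1 + (1 + r) * g) + 1 ≡ (1 + r) * (r * g + 1)
  eq = solve-∀

σ-local : ℕ → ℕ → ℕ → ℕ
σ-local p k j = geom p (suc k) * (1 + p ^ j)

-- The quotient by `p ^ (k + j)` is exactly `1 + 1/p` for exponent 1, and from `k = 1` on the two
-- top terms of the sum reach it. Exponent 2 has only the value `1 + p * p`, hence the exception.
σ-local-lower : ∀ p {k j} → Exponents k j →
                (k ≡ 0 × j ≡ 2) ⊎ (1 + p) * p ^ (k + j) ≤ p * σ-local p k j
σ-local-lower p {zero}  odd-exponent  = inj₂ (≤-reflexive (eq p))
  where
  eq : ∀ p → (1 + p) * (p * 1) ≡ p * ((1 + p * 0) * (1 + p * 1))
  eq = solve-∀
σ-local-lower p {zero}  even-exponent = inj₁ (refl , refl)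
σ-local-lower p {suc k} {j} _ = inj₂ (begin
  (1 + p) * p ^ (suc k + j)               ≡⟨ cong ((1 + p) *_) (^-distribˡ-+-* p (suc k) j) ⟩
  (1 + p) * (p ^ suc k * p ^ j)           ≡⟨ *-assoc (1 + p) (p ^ suc k) (p ^ j) ⟨
  (1 + p) * p ^ suc k * p ^ j             ≤⟨ *-mono-≤ (geom-lower p k) (n≤1+n (p ^ j)) ⟩
  p * geom p (2 + k) * (1 + p ^ j)        ≡⟨ *-assoc p (geom p (2 + k)) (1 + p ^ j) ⟩
  p * (geom p (2 + k) * (1 + p ^ j))      ∎)
  where open ≤-Reasoning

-- This is the bound `p / (p - 1)` with `p = 1 + r`. Since `r * g < p ^ suc k ≤ p ^ j`, the lone
-- summand `r * g` may be replaced by `p ^ j`, which completes the factor `r * g + 1 = p ^ suc k`.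
σ-local-upper : ∀ r {k j} → Exponents k j →
                r * σ-local (1 + r) k j ≤ (1 + r) * (1 + r) ^ (k + j)
σ-local-upper r {k} {j} kj = begin
  r * (g * (1 + X))             ≡⟨ eq r g X ⟩
  r * g + r * g * X             ≤⟨ +-monoˡ-≤ _ rg≤X ⟩
  X + r * g * X                 ≡⟨ eq′ r g X ⟩
  (r * g + 1) * X               ≡⟨ cong (_* X) (geom-closed r (suc k)) ⟩
  (1 + r) ^ suc k * X           ≡⟨ ^-distribˡ-+-* (1 + r) (suc k) j ⟨
  (1 + r) * (1 + r) ^ (k + j)   ∎
  where
  open ≤-Reasoning
  g = geom (1 + r) (suc k)
  X = (1 + r) ^ j
  rg≤X : r * g ≤ X
  rg≤X = ≤-trans (m+n≤o⇒m≤o (r * g) (≤-reflexive (geom-closed r (suc k))))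
                 (^-monoʳ-≤ (1 + r) (exponents-k<j kj))
  eq : ∀ r g X → r * (g * (1 + X)) ≡ r * g + r * g * X
  eq = solve-∀
  eq′ : ∀ r g X → X + r * g * X ≡ (r * g + 1) * X
  eq′ = solve-∀

^<σ-local : ∀ p k j → p ^ (k + j) < σ-local p k j
^<σ-local p k j = begin-strict
  p ^ (k + j)                     ≡⟨ ^-distribˡ-+-* p k j ⟩
  p ^ k * p ^ j                   <⟨ s≤s (≤-trans (*-monoˡ-≤ (p ^ j) (^≤geom p k)) (m≤n+m (g * p ^ j) (p * geom p k))) ⟩
  g + g * p ^ j                   ≡⟨ *-suc g (p ^ j) ⟨
  g * (1 + p ^ j)                 ∎
  where
  open ≤-Reasoning
  g = geom p (suc k)

σ-local-even : ∀ {p} k j → 2 ∤ p → 2 ∣ σ-local p k j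
σ-local-even {p} k j 2∤p = ∣n⇒∣m*n (geom p (suc k)) (odd⇒2∣1+ (2∤p ∘ prime-∣-^ p j prime[2]))

prime-∤-suc : ∀ {p n} → Prime p → p ∣ n → p ∤ 1 + n
prime-∤-suc {p} {n} pp p∣n p∣1+n
  with refl ← ∣1⇒≡1 (∣m+n∣m⇒∣n (subst (p ∣_) (+-comm 1 n) p∣1+n) p∣n) = ¬prime[1] pp

-- Both factors are 1 modulo `p`, as `j` is positive.
∤-σ-local : ∀ {p k j} → Prime p → Exponents k j → p ∤ σ-local p k j
∤-σ-local {p} {k} {j} pp kj p∣ with euclidsLemma (geom p (suc k)) (1 + p ^ j) pp p∣
... | inj₁ p∣g   = prime-∤-suc pp (m∣m*n (geom p k)) p∣g
... | inj₂ p∣1+X = prime-∤-suc pp (p∣pʲ kj) p∣1+X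
  where
  p∣pʲ : ∀ {k j} → Exponents k j → p ∣ p ^ j
  p∣pʲ odd-exponent  = m∣m*n _
  p∣pʲ even-exponent = m∣m*n _

-- If `n = c * p` with `c > 1` and `q` is a prime divisor of `c`, then `q * p ≤ n`. Roughness at `p`
-- gives `q < p`, and roughness at `q` gives `p < q`.
prime-if-rough : ∀ {n} → 1 < n → (∀ {p} → Prime p → p ∣ n → n < p * p) → Prime n
prime-if-rough {n} 1<n rough with prime-divisor 1<n
... | p , pp , divides-refl zero = contradiction 1<n λ ()
... | p , pp , divides-refl (suc zero) = subst Prime (sym (*-identityˡ p)) pp
... | p , pp , divides-refl c@(suc (suc _)) with prime-divisor {c} (s≤s (s≤s z≤n))
... | q , pq , q∣c = contradiction
  (*-cancelʳ-< p q p (≤-<-trans qp≤cp (rough pp (n∣m*n c))))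
  (<-asym (*-cancelˡ-< q p q (≤-<-trans qp≤cp (rough pq (∣m⇒∣m*n p q∣c)))))
  where
  qp≤cp : q * p ≤ c * p
  qp≤cp = *-monoˡ-≤ p (∣⇒≤ q∣c)

-- Confronts a lower bound `1 + 1/s` with an upper bound `V / W` for the same quotient `F / n`.
ratio-≤ : ∀ {s n F W V} → 1 ≤ n → (1 + s) * n ≤ s * F → F * W ≤ V * n → (1 + s) * W ≤ s * V
ratio-≤ {s} {n} {F} {W} {V} 1≤n lower upper =
  *-cancelʳ-≤ ((1 + s) * W) (s * V) n {{>-nonZero 1≤n}} (begin
    (1 + s) * W * n     ≡⟨ eq (1 + s) W n ⟩
    (1 + s) * n * W     ≤⟨ *-monoˡ-≤ W lower ⟩
    s * F * W           ≡⟨ *-assoc s F W ⟩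
    s * (F * W)         ≤⟨ *-monoʳ-≤ s upper ⟩
    s * (V * n)         ≡⟨ *-assoc s V n ⟨
    s * V * n           ∎)
  where
  open ≤-Reasoning
  eq : ∀ a b c → a * b * c ≡ a * c * b
  eq = solve-∀

suc-*-≤ : ∀ {s t} → s ≤ t → s * (1 + t) ≤ (1 + s) * t
suc-*-≤ {s} {t} s≤t = ≤-trans (≤-reflexive (*-suc s t)) (+-monoˡ-≤ (s * t) s≤t)

odd-∤-double : ∀ n → 2 ∤ 1 + 2 * n
odd-∤-double n 2∣1+2n = contradiction (∣1⇒≡1 (∣m+n∣m⇒∣n (subst (2 ∣_) (+-comm 1 (2 * n)) 2∣1+2n) (m∣m*n n))) λ ()

odd-prime-∣-double : ∀ {p t x} → 2 ∤ t → Prime p → p ∣ t → p ∣ 2 * x → p ∣ x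
odd-prime-∣-double {p} {t} {x} 2∤t pp p∣t p∣2x with euclidsLemma 2 x pp p∣2x
... | inj₂ p∣x = p∣x
... | inj₁ p∣2 with refl ← prime-∣-prime pp prime[2] p∣2 = contradiction p∣t 2∤t

2∤x⇒4∤2x : ∀ {x} → 2 ∤ x → 4 ∤ 2 * x
2∤x⇒4∤2x 2∤x 4∣2x = 2∤x (*-cancelˡ-∣ 2 4∣2x)

prime[3] : Prime 3
prime[3] = from-yes (prime? 3)

prime-∣-3+2* : ∀ {t} → Prime t → t ∣ 3 + 2 * t → t ≡ 3
prime-∣-3+2* {t} pt t∣w = prime-∣-prime pt prime[3]
  (∣m+n∣m⇒∣n (subst (t ∣_) (+-comm 3 (2 * t)) t∣w) (n∣m*n 2))

-- D = (t² + 1) / 2 and E = (w² + 1) / 2 for t = 2 g + 1 and w = 2 t + 3.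
D∤E : ∀ {g} → 1 ≤ g → 1 + 2 * g * (1 + g) ∤ 13 + 20 * g + 8 * (g * g)
D∤E {g} 1≤g D∣E = none g 1≤g (∣m+n∣m⇒∣n (subst (1 + 2 * g * (1 + g) ∣_) (eq g) D∣E) (n∣m*n 4))
  where
  eq : ∀ g → 13 + 20 * g + 8 * (g * g) ≡ 4 * (1 + 2 * g * (1 + g)) + (9 + 12 * g)
  eq = solve-∀
  eq₂ : ∀ h → 1 + 2 * (6 + h) * (1 + (6 + h)) ≡ 1 + (9 + 12 * (6 + h)) + (3 + 14 * h + 2 * (h * h))
  eq₂ = solve-∀
  none : ∀ g → 1 ≤ g → 1 + 2 * g * (1 + g) ∤ 9 + 12 * g
  none 1 _ = from-no (5 ∣? 21)
  none 2 _ = from-no (13 ∣? 33)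
  none 3 _ = from-no (25 ∣? 45)
  none 4 _ = from-no (41 ∣? 57)
  none 5 _ = from-no (61 ∣? 69)
  none (suc (suc (suc (suc (suc (suc h)))))) _ =
    >⇒∤ (≤-trans (m≤m+n _ (3 + 14 * h + 2 * (h * h))) (≤-reflexive (sym (eq₂ h))))

-- Arithmetic at the small primes 3, 5, 13 and 17

prime[5] : Prime 5
prime[5] = from-yes (prime? 5)

prime[13] : Prime 13
prime[13] = from-yes (prime? 13)

-- Consecutive terms add up to a multiple of `1 + 5`. The use: as soon as such a sum is even, it
-- brings the prime 3 along.
geom-5-mod-6 : ∀ n → 6 ∣ geom 5 n ⊎ ∃ λ c → geom 5 n ≡ c * 6 + 1
geom-5-mod-6 zero = inj₁ (6 ∣0)
geom-5-mod-6 (suc zero) = inj₂ (0 , refl)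
geom-5-mod-6 (suc (suc n)) with geom-5-mod-6 n
... | inj₁ (divides-by c g≡) = inj₁ (divides-by (1 + 25 * c)
        (trans (cong (λ g → 1 + 5 * (1 + 5 * g)) g≡) (eq c)))
  where
  eq : ∀ c → 1 + 5 * (1 + 5 * (c * 6)) ≡ (1 + 25 * c) * 6
  eq = solve-∀
... | inj₂ (c , g≡) = inj₂ (5 + 25 * c , trans (cong (λ g → 1 + 5 * (1 + 5 * g)) g≡) (eq c))
  where
  eq : ∀ c → 1 + 5 * (1 + 5 * (c * 6 + 1)) ≡ (5 + 25 * c) * 6 + 1
  eq = solve-∀

-- The residues run through 0, 1, 4, 13 with period 4, so an odd number of terms gives a sum prime
-- to 10.
geom-3-mod-20 : ∀ n → 4 ∣ geom 3 n ⊎ ∃ λ c → geom 3 n ≡ c * 20 + 1 ⊎ geom 3 n ≡ c * 20 + 13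
geom-3-mod-20 zero = inj₁ (4 ∣0)
geom-3-mod-20 (suc zero) = inj₂ (0 , inj₁ refl)
geom-3-mod-20 (suc (suc n)) with geom-3-mod-20 n
... | inj₁ (divides-by c g≡) = inj₁ (divides-by (1 + 9 * c)
        (trans (cong (λ g → 1 + 3 * (1 + 3 * g)) g≡) (eq c)))
  where
  eq : ∀ c → 1 + 3 * (1 + 3 * (c * 4)) ≡ (1 + 9 * c) * 4
  eq = solve-∀
... | inj₂ (c , inj₁ g≡) = inj₂ (9 * c , inj₂ (trans (cong (λ g → 1 + 3 * (1 + 3 * g)) g≡) (eq c)))
  where
  eq : ∀ c → 1 + 3 * (1 + 3 * (c * 20 + 1)) ≡ 9 * c * 20 + 13
  eq = solve-∀
... | inj₂ (c , inj₂ g≡) = inj₂ (6 + 9 * c , inj₁ (trans (cong (λ g → 1 + 3 * (1 + 3 * g)) g≡) (eq c)))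
  where
  eq : ∀ c → 1 + 3 * (1 + 3 * (c * 20 + 13)) ≡ (6 + 9 * c) * 20 + 1
  eq = solve-∀

∣-remainder : ∀ {d n} c e r → d ∣ e → n ≡ c * e + r → d ∣ n → d ∣ r
∣-remainder {d} c e r d∣e n≡ d∣n = ∣m+n∣m⇒∣n (subst (d ∣_) n≡ d∣n) (∣n⇒∣m*n c d∣e)

geom-3-prime-factors : ∀ n → ¬ 4 ∣ geom 3 n → 2 ∤ geom 3 n × 5 ∤ geom 3 n
geom-3-prime-factors n 4∤ with geom-3-mod-20 n
... | inj₁ 4∣ = contradiction 4∣ 4∤
... | inj₂ (c , inj₁ g≡) = from-no (2 ∣? 1) ∘ ∣-remainder c 20 1 (divides-by 10 refl) g≡
                         , from-no (5 ∣? 1) ∘ ∣-remainder c 20 1 (divides-by 4 refl) g≡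
... | inj₂ (c , inj₂ g≡) = from-no (2 ∣? 13) ∘ ∣-remainder c 20 13 (divides-by 10 refl) g≡
                         , from-no (5 ∣? 13) ∘ ∣-remainder c 20 13 (divides-by 4 refl) g≡

exponents-1≤j : ∀ {k j} → Exponents k j → 1 ≤ j
exponents-1≤j kj = ≤-trans (s≤s z≤n) (exponents-k<j kj)

1<geom : ∀ p n → 1 ≤ p → 1 < geom p (2 + n)
1<geom p n 1≤p = s≤s (*-mono-≤ 1≤p (s≤s z≤n))

-- Here `X` is `5 ^ suc k` and `Y` is `5 ^ j`. Modulo a divisor of `G` the power `X` is 1, so
-- `2 * h = 1 + r * X` becomes `1 + r`; the two parities of the exponent have `r = 1` and `r = 5`.
common-divisor : ∀ {G h X Y r q} → 2 * h ≡ 1 + Y → 4 * G + 1 ≡ X → Y ≡ r * X →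
                 q ∣ G → q ∣ h → q ∣ 1 + r
common-divisor {G} {h} {X} {Y} {r} {q} 2h≡ X≡ Y≡ q∣G q∣h =
  ∣m+n∣m⇒∣n (subst (q ∣_) eq (∣n⇒∣m*n 2 q∣h)) (∣n⇒∣m*n (r * 4) q∣G)
  where
  open ≡-Reasoning
  expand : ∀ r G → 1 + r * (4 * G + 1) ≡ r * 4 * G + (1 + r)
  expand = solve-∀
  eq : 2 * h ≡ r * 4 * G + (1 + r)
  eq = begin
    2 * h                   ≡⟨ 2h≡ ⟩
    1 + Y                   ≡⟨ cong suc Y≡ ⟩
    1 + r * X               ≡⟨ cong (λ y → 1 + r * y) X≡ ⟨
    1 + r * (4 * G + 1)     ≡⟨ expand r G ⟩
    r * 4 * G + (1 + r)     ∎

prime[17] : Prime 17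
prime[17] = from-yes (prime? 17)

interchange : ∀ a b x y → a * b * (x * y) ≡ a * x * (b * y)
interchange = solve-∀

*-bounds : ∀ {a b c d X Y F G} → a * X ≤ b * F → c * Y ≤ d * G → a * c * (X * Y) ≤ b * d * (F * G)
*-bounds {a} {b} {c} {d} {X} {Y} {F} {G} aX≤bF cY≤dG = begin
  a * c * (X * Y)      ≡⟨ interchange a c X Y ⟩
  a * X * (c * Y)      ≤⟨ *-mono-≤ aX≤bF cY≤dG ⟩
  b * F * (d * G)      ≡⟨ interchange b d F G ⟨
  b * d * (F * G)      ∎
  where open ≤-Reasoning

prime-∣-^* : ∀ {p q} e {n} → Prime p → p ∤ q → p ∣ q ^ e * n → p ∣ n
prime-∣-^* {p} {q} e {n} pp p∤q p∣ with euclidsLemma (q ^ e) n pp p∣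
... | inj₁ p∣qᵉ = contradiction (prime-∣-^ q e pp p∣qᵉ) p∤q
... | inj₂ p∣n  = p∣n

prime-∣-*ʳ : ∀ {p} a {n} → Prime p → p ∤ a → p ∣ a * n → p ∣ n
prime-∣-*ʳ a {n} pp p∤a p∣an with euclidsLemma a n pp p∣an
... | inj₁ p∣a = contradiction p∣a p∤a
... | inj₂ p∣n = p∣n

∣-coefficient : ∀ {d} a n → {True (d ∣? a)} → d ∣ a * n
∣-coefficient a n {d∣a} = ∣m⇒∣m*n {m = a} n (toWitness d∣a)

-- Abundancy bounds for a multiplicative function with these local factors

-- The whole argument runs from these three facts. With `f` a variable, terms such as `f 25` do not
-- unfold into a search for divisors.
module Superperfect
  (f : ℕ → ℕ)
  (f-1 : f 1 ≡ 1)
  (f-* : ∀ {m n} → 1 ≤ m → 1 ≤ n → Coprime m n → f (m * n) ≡ f m * f n)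
  (f-prime-power : ∀ {p k j} → Prime p → Exponents k j → f (p ^ (k + j)) ≡ σ-local p k j)
  where

  record Part (p n : ℕ) : Set where
    constructor part
    field
      {k j}    : ℕ
      exps     : Exponents k j
      rest     : ℕ
      factors  : n ≡ p ^ (k + j) * rest
      ∤-rest   : p ∤ rest
      f-factors : f n ≡ σ-local p k j * f rest

  f-split : ∀ {p k j m} → Prime p → Exponents k j → p ∤ m →
            f (p ^ (k + j) * m) ≡ σ-local p k j * f m
  f-split {p} {k} {j} {m} pp kj p∤m = trans
    (f-* (m^n>0 p {{prime⇒nonZero pp}} (k + j)) (∤⇒positive p∤m) (coprime-^ (k + j) (prime-∤⇒coprime pp p∤m)))
    (cong (_* f m) (f-prime-power pp kj))

  part-of : ∀ {p n} → Prime p → 1 ≤ n → p ∣ n → Part p n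
  part-of {p} {n} pp 1≤n p∣n with prime-part pp n 1≤n
  ... | zero  , m , refl , p∤m = contradiction (subst (p ∣_) (*-identityˡ m) p∣n) p∤m
  ... | suc e , m , refl , p∤m with exponents e
  ... | k , j , kj , k+j = part kj m (cong (λ e → p ^ e * m) (sym k+j)) p∤m
    (trans (cong (λ e → f (p ^ e * m)) (sym k+j)) (f-split pp kj p∤m))

  -- The square case keeps the exact factor because its value matters later: 10 at the prime 3, 170
  -- at 13, 290 at 17, and twice an odd number at `t` and `w`.
  data Local (p n : ℕ) : Set where
    square : ∀ m → n ≡ p * p * m → p ∤ m → f n ≡ (1 + p * p) * f m → Local p n
    large  : (1 + p) * n ≤ p * f n → Local p n

  f-increasing : ∀ n → 1 < n → n < f n
  f-increasing = <-rec _ step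
    where
    step : ∀ n → (∀ {m} → m < n → 1 < m → m < f m) → 1 < n → n < f n
    step n rec 1<n with prime-divisor 1<n
    ... | p , pp , p∣n with part-of pp (<⇒≤ 1<n) p∣n
    ... | part {k} {j} kj m refl p∤m fn≡ = begin-strict
      p ^ (k + j) * m          <⟨ *-monoˡ-< m {{>-nonZero 1≤m}} (^<σ-local p k j) ⟩
      σ-local p k j * m        ≤⟨ *-monoʳ-≤ (σ-local p k j) m≤fm ⟩
      σ-local p k j * f m      ≡⟨ fn≡ ⟨
      f (p ^ (k + j) * m)      ∎
      where
      open ≤-Reasoning
      1≤m = ∤⇒positive p∤m
      1<pᵏʲ : 1 < p ^ (k + j)
      1<pᵏʲ = ^-monoʳ-< p (prime⇒1< pp) {0} (≤-trans (≤-trans (s≤s z≤n) (exponents-k<j kj)) (m≤n+m j k))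
      m≤fm : m ≤ f m
      m≤fm with 1 <? m
      ... | yes 1<m = <⇒≤ (rec (subst (m <_) (*-comm m _) (m<m*n m (p ^ (k + j)) {{>-nonZero 1≤m}} 1<pᵏʲ)) 1<m)
      ... | no  1≮m with ≤-antisym (≮⇒≥ 1≮m) 1≤m
      ... | refl = ≤-reflexive (sym f-1)

  ≤f : ∀ {n} → 1 ≤ n → n ≤ f n
  ≤f {n} 1≤n with m≤n⇒m<n∨m≡n 1≤n
  ... | inj₁ 1<n  = <⇒≤ (f-increasing n 1<n)
  ... | inj₂ refl = ≤-reflexive (sym f-1)

  local : ∀ {p n} → Prime p → 1 ≤ n → p ∣ n → Local p n
  local {p} {n} pp 1≤n p∣n with part-of pp 1≤n p∣n
  ... | part {k} {j} kj m refl p∤m fn≡ with σ-local-lower p kj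
  ... | inj₁ (refl , refl) = square m (cong (λ x → p * x * m) (*-identityʳ p)) p∤m
          (trans fn≡ (cong (_* f m) (eq p)))
    where
    eq : ∀ p → (1 + p * 0) * (1 + p * (p * 1)) ≡ 1 + p * p
    eq = solve-∀
  ... | inj₂ lower = large (begin
      (1 + p) * (p ^ (k + j) * m)    ≡⟨ *-assoc (1 + p) (p ^ (k + j)) m ⟨
      (1 + p) * p ^ (k + j) * m      ≤⟨ *-mono-≤ lower (≤f (∤⇒positive p∤m)) ⟩
      p * σ-local p k j * f m        ≡⟨ *-assoc p (σ-local p k j) (f m) ⟩
      p * (σ-local p k j * f m)      ≡⟨ cong (p *_) fn≡ ⟨
      p * f (p ^ (k + j) * m)        ∎)
    where open ≤-Reasoning

  local-square : ∀ {p n} → Prime p → 1 ≤ n → p ∣ n → (1 + p * p) * n ≤ p * p * f n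
  local-square {p} {n} pp 1≤n p∣n with local pp 1≤n p∣n
  ... | square m refl p∤m fn≡ = begin
      (1 + p * p) * (p * p * m)      ≡⟨ eq (p * p) m ⟩
      p * p * ((1 + p * p) * m)      ≤⟨ *-monoʳ-≤ (p * p) (*-monoʳ-≤ (1 + p * p) (≤f (∤⇒positive p∤m))) ⟩
      p * p * ((1 + p * p) * f m)    ≡⟨ cong (p * p *_) fn≡ ⟨
      p * p * f (p * p * m)          ∎
    where
    open ≤-Reasoning
    eq : ∀ q m → (1 + q) * (q * m) ≡ q * ((1 + q) * m)
    eq = solve-∀
  ... | large lower = begin
      (1 + p * p) * n                ≤⟨ *-monoˡ-≤ n (+-monoˡ-≤ (p * p) (<⇒≤ (prime⇒1< pp))) ⟩
      (p + p * p) * n                ≡⟨ eq p n ⟩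
      p * ((1 + p) * n)              ≤⟨ *-monoʳ-≤ p lower ⟩
      p * (p * f n)                  ≡⟨ *-assoc p p (f n) ⟨
      p * p * f n                    ∎
    where
    open ≤-Reasoning
    eq : ∀ p n → (p + p * p) * n ≡ p * ((1 + p) * n)
    eq = solve-∀

  f-even : ∀ {n} → 1 < n → 2 ∤ n → 2 ∣ f n
  f-even {n} 1<n 2∤n with prime-divisor 1<n
  ... | p , pp , p∣n with part-of pp (<⇒≤ 1<n) p∣n
  ... | part {k} {j} kj m refl p∤m fn≡ = subst (2 ∣_) (sym fn≡)
          (∣m⇒∣m*n (f m) (σ-local-even k j (λ 2∣p → 2∤n (∣-trans 2∣p p∣n))))

  -- The last hypothesis says `h(n) < 1 + 1/s` for all `s ≤ t`. A prime `p` of `t` with `p * p ≤ t`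
  -- violates it at `s = p * p`, so `t` is prime; the `large` alternative violates it at `s = t`.
  squares-only : ∀ {n t} → 1 ≤ n → 1 < t → (∀ {p} → Prime p → p ∣ t → p ∣ n) →
                 (∀ {s} → 1 ≤ s → s ≤ t → (1 + s) * n ≰ s * f n) →
                 Prime t × ∃ λ m → n ≡ t * t * m × t ∤ m × f n ≡ (1 + t * t) * f m
  squares-only {n} {t} 1≤n 1<t t∣n small = pt , square-part (local pt 1≤n (t∣n pt ∣-refl))
    where
    pt : Prime t
    pt = prime-if-rough 1<t λ {p} pp p∣t → ≰⇒> λ pp≤t →
      small (*-mono-≤ (<⇒≤ (prime⇒1< pp)) (<⇒≤ (prime⇒1< pp))) pp≤t (local-square pp 1≤n (t∣n pp p∣t))
    square-part : Local t n → ∃ λ m → n ≡ t * t * m × t ∤ m × f n ≡ (1 + t * t) * f m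
    square-part (square m n≡ t∤m fn≡) = m , n≡ , t∤m , fn≡
    square-part (large lower)         = contradiction lower (small (<⇒≤ 1<t) ≤-refl)

  -- The refuted bound is `1 + 1/(t * (t + 2))`, while a prime `p` of `t` gives at least
  -- `1 + 1/(p * p)` and `p ≤ t`.
  abundancy-odd-exponent : ∀ {n t} → 1 ≤ n → 1 < t → (∀ {p} → Prime p → p ∣ t → p ∣ n) →
                           f n * (t * (2 + t)) ≰ (1 + t) * (1 + t) * n
  abundancy-odd-exponent {n} {t} 1≤n 1<t t∣n upper with prime-divisor 1<t
  ... | p , pp , p∣t = contradiction W≤p² (<⇒≱ (begin-strict
      p * p          ≤⟨ *-mono-≤ p≤t p≤t ⟩
      t * t          <⟨ *-monoʳ-< t {{>-nonZero (<⇒≤ 1<t)}} (m≤n+m (1 + t) 1) ⟩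
      t * (2 + t)    ∎))
    where
    open ≤-Reasoning
    p≤t : p ≤ t
    p≤t = ∣⇒≤ {{>-nonZero (<⇒≤ 1<t)}} p∣t
    eq : ∀ q t → q * ((1 + t) * (1 + t)) ≡ q + q * (t * (2 + t))
    eq = solve-∀
    W≤p² : t * (2 + t) ≤ p * p
    W≤p² = +-cancelʳ-≤ (p * p * (t * (2 + t))) _ _
      (≤-trans (ratio-≤ {p * p} {n} {f n} {t * (2 + t)} {(1 + t) * (1 + t)} 1≤n
        (local-square pp 1≤n (t∣n pp p∣t)) upper) (≤-reflexive (eq (p * p) t)))

  -- The bound equals `1 + (t + 2)/(t * (2t + 3))`, which is below `1 + 1/t` because
  -- `t + 2 < 2t + 3`.
  abundancy-even-exponent : ∀ {n t} → 1 ≤ n → 1 < t → (∀ {p} → Prime p → p ∣ t → p ∣ n) →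
    f n * (t * (3 + 2 * t)) ≤ 2 * ((1 + t) * (1 + t)) * n →
    Prime t × ∃ λ m → n ≡ t * t * m × t ∤ m × f n ≡ (1 + t * t) * f m
  abundancy-even-exponent {n} {t} 1≤n 1<t t∣n upper = squares-only 1≤n 1<t t∣n small
    where
    open ≤-Reasoning
    eq₁ : ∀ s t → s * (1 + t) * (3 + 2 * t) ≡ s * (2 * ((1 + t) * (1 + t))) + s * (1 + t)
    eq₁ = solve-∀
    small : ∀ {s} → 1 ≤ s → s ≤ t → (1 + s) * n ≰ s * f n
    small {s} 1≤s s≤t lower = <⇒≱ (begin-strict
      s * (2 * ((1 + t) * (1 + t)))                  <⟨ m<m+n _ (*-mono-≤ 1≤s (s≤s z≤n)) ⟩
      s * (2 * ((1 + t) * (1 + t))) + s * (1 + t)    ≡⟨ eq₁ s t ⟨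
      s * (1 + t) * (3 + 2 * t)                      ≤⟨ *-monoˡ-≤ (3 + 2 * t) (suc-*-≤ s≤t) ⟩
      (1 + s) * t * (3 + 2 * t)                      ≡⟨ *-assoc (1 + s) t (3 + 2 * t) ⟩
      (1 + s) * (t * (3 + 2 * t))                    ∎)
      (ratio-≤ {s} {n} {f n} {t * (3 + 2 * t)} {2 * ((1 + t) * (1 + t))} 1≤n lower upper)

  -- Values at powers of two, and the generic case of odd `x`

  -- With `g = 2 ^ k - 1`, the factor `1 + 2 * g` is `t`, and the second factor is `t + 2` or
  -- `2 * t + 3`. The exponents 1 and 2 are those with `g = 0`.
  data TwoPower (C : ℕ) : Set where
    odd-power  : ∀ g → C ≡ 2 * ((1 + g) * (1 + g)) → f C ≡ (1 + 2 * g) * (3 + 2 * g) → TwoPower C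
    even-power : ∀ g → C ≡ 4 * ((1 + g) * (1 + g)) → f C ≡ (1 + 2 * g) * (5 + 4 * g) → TwoPower C

  two-power : ∀ e → TwoPower (2 ^ suc e)
  two-power e with exponents e
  ... | k , j , kj , k+j = subst (TwoPower ∘ (2 ^_)) k+j (shape kj)
    where
    2^≡ : ∀ k → 2 ^ k ≡ 1 + geom 2 k
    2^≡ k = trans (sym (geom-closed 1 k)) (eq (geom 2 k))
      where
      eq : ∀ g → 1 * g + 1 ≡ 1 + g
      eq = solve-∀
    shape : ∀ {k j} → Exponents k j → TwoPower (2 ^ (k + j))
    shape {k} odd-exponent = odd-power (geom 2 k)
      (trans (^-distribˡ-+-* 2 k (1 + k)) (trans (cong (λ x → x * (2 * x)) (2^≡ k)) (eq₁ (geom 2 k))))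
      (trans (f-prime-power {k = k} prime[2] odd-exponent)
        (trans (cong (λ x → geom 2 (suc k) * (1 + 2 * x)) (2^≡ k)) (eq₂ (geom 2 k))))
      where
      eq₁ : ∀ g → (1 + g) * (2 * (1 + g)) ≡ 2 * ((1 + g) * (1 + g))
      eq₁ = solve-∀
      eq₂ : ∀ g → (1 + 2 * g) * (1 + 2 * (1 + g)) ≡ (1 + 2 * g) * (3 + 2 * g)
      eq₂ = solve-∀
    shape {k} even-exponent = even-power (geom 2 k)
      (trans (^-distribˡ-+-* 2 k (2 + k)) (trans (cong (λ x → x * (2 * (2 * x))) (2^≡ k)) (eq₁ (geom 2 k))))
      (trans (f-prime-power {k = k} prime[2] even-exponent)
        (trans (cong (λ x → geom 2 (suc k) * (1 + 2 * (2 * x))) (2^≡ k)) (eq₂ (geom 2 k))))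
      where
      eq₁ : ∀ g → (1 + g) * (2 * (2 * (1 + g))) ≡ 4 * ((1 + g) * (1 + g))
      eq₁ = solve-∀
      eq₂ : ∀ g → (1 + 2 * g) * (1 + 2 * (2 * (1 + g))) ≡ (1 + 2 * g) * (5 + 4 * g)
      eq₂ = solve-∀

  f-even-cofactor : ∀ {m} → 1 ≤ m → 2 ∤ m → m ≡ 1 ⊎ 2 ∣ f m
  f-even-cofactor 1≤m 2∤m with m≤n⇒m<n∨m≡n 1≤m
  ... | inj₁ 1<m  = inj₂ (f-even 1<m 2∤m)
  ... | inj₂ refl = inj₁ refl

  record PowerOf (q n : ℕ) : Set where
    constructor power-of
    field
      {k j}    : ℕ
      exps     : Exponents k j
      ≡power   : n ≡ q ^ (k + j)

  -- Two distinct odd primes dividing M would contribute two factors 2 to f M.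
  prime-power-if-4∤ : ∀ {q M} → Prime q → 2 ∤ M → 4 ∤ f M → q ∣ M → PowerOf q M
  prime-power-if-4∤ {q} {M} pq 2∤M 4∤fM q∣M with part-of pq (∤⇒positive 2∤M) q∣M
  ... | part {k} {j} kj m M≡ q∤m fM≡ with f-even-cofactor (∤⇒positive q∤m)
    (λ 2∣m → 2∤M (subst (2 ∣_) (sym M≡) (∣n⇒∣m*n (q ^ (k + j)) 2∣m)))
  ... | inj₁ refl  = power-of kj (trans M≡ (*-identityʳ _))
  ... | inj₂ 2∣fm = contradiction (subst (4 ∣_) (sym fM≡)
          (*-pres-∣ (σ-local-even k j (λ 2∣q → 2∤M (∣-trans 2∣q q∣M))) 2∣fm)) 4∤fM

  -- Divisors of a power of `q` are powers of `q`, which divisibility orders linearly; `D ≤ E`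
  -- decides the direction.
  prime-powers-∣ : ∀ {q M D E} → Prime q → PowerOf q M → D ≤ E → D ∣ M → E ∣ M → D ∣ E
  prime-powers-∣ {q} {M} {D} {E} pq (power-of {k} {j} _ refl) D≤E D∣M E∣M
    with prime-power-factors pq (k + j) {D} (m∣n⇒n≡m*quotient D∣M)
       | prime-power-factors pq (k + j) {E} (m∣n⇒n≡m*quotient E∣M)
  ... | i , _ , refl , _ , _ | l , _ , refl , _ , _ with ≤-total i l
  ... | inj₂ l≤i = ∣-reflexive (≤-antisym D≤E (^-monoʳ-≤ q {{prime⇒nonZero pq}} l≤i))
  ... | inj₁ i≤l with d , refl ← m≤n⇒∃[o]m+o≡n i≤l =
    subst (q ^ i ∣_) (sym (^-distribˡ-+-* q i d)) (m∣m*n (q ^ d))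

  -- Reads `h(x) ≤ V / A`. With `C` the 2-part of `f x`, `A = f C` and `V = 2 * C`, it is
  -- `h(x) h(C) h(M) = 2` after dropping `h(M) ≥ 1`.
  upper-bound : ∀ {x M A V} → 1 ≤ M → A * f M ≡ 2 * x → 2 * f x ≡ V * M → f x * A ≤ V * x
  upper-bound {x} {M} {A} {V} 1≤M fy≡ fx≡ = *-cancelʳ-≤ (f x * A) (V * x) (f M)
    {{>-nonZero (≤-trans 1≤M (≤f 1≤M))}} (begin
      f x * A * f M      ≡⟨ *-assoc (f x) A (f M) ⟩
      f x * (A * f M)    ≡⟨ cong (f x *_) fy≡ ⟩
      f x * (2 * x)      ≡⟨ eq₁ (f x) x ⟩
      2 * f x * x        ≡⟨ cong (_* x) fx≡ ⟩
      V * M * x          ≤⟨ *-monoˡ-≤ x (*-monoʳ-≤ V (≤f 1≤M)) ⟩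
      V * f M * x        ≡⟨ eq₂ V (f M) x ⟩
      V * x * f M        ∎)
    where
    open ≤-Reasoning
    eq₁ : ∀ a b → a * (2 * b) ≡ 2 * a * b
    eq₁ = solve-∀
    eq₂ : ∀ a b c → a * b * c ≡ a * c * b
    eq₂ = solve-∀

  odd-power-case : ∀ {x M g} → 1 ≤ x → 1 ≤ M → 1 ≤ g →
    (1 + 2 * g) * (3 + 2 * g) * f M ≡ 2 * x → f x ≡ 2 * ((1 + g) * (1 + g)) * M → ⊥
  odd-power-case {x} {M} {g} 1≤x 1≤M 1≤g fy≡ fx≡ =
    abundancy-odd-exponent 1≤x (s≤s (*-mono-≤ {1} {2} (s≤s z≤n) 1≤g))
      (λ {p} pp p∣t → odd-prime-∣-double (odd-∤-double g) pp p∣t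
        (subst (p ∣_) fy≡ (∣m⇒∣m*n (f M) (∣m⇒∣m*n (3 + 2 * g) p∣t))))
      (upper-bound {V = (1 + (1 + 2 * g)) * (1 + (1 + 2 * g))} 1≤M fy≡ (trans (cong (2 *_) fx≡) (eq g M)))
    where
    eq : ∀ g M → 2 * (2 * ((1 + g) * (1 + g)) * M) ≡ (1 + (1 + 2 * g)) * (1 + (1 + 2 * g)) * M
    eq = solve-∀

  even-power-case : ∀ {x M g} → 2 ∤ x → 2 ∤ M → 1 ≤ g →
    (1 + 2 * g) * (5 + 4 * g) * f M ≡ 2 * x → f x ≡ 4 * ((1 + g) * (1 + g)) * M → ⊥
  even-power-case {x} {M} {g} 2∤x 2∤M 1≤g fy≡ fx≡ = conclude
    (abundancy-even-exponent 1≤x 1<t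
      (λ {p} pp p∣t → odd-prime-∣-double (odd-∤-double g) pp p∣t
        (subst (p ∣_) fy≡ (∣m⇒∣m*n (f M) (∣m⇒∣m*n (5 + 4 * g) p∣t)))) bound)
    where
    t w : ℕ
    t = 1 + 2 * g
    w = 5 + 4 * g
    1≤x = ∤⇒positive 2∤x
    1≤M = ∤⇒positive 2∤M
    1<t : 1 < t
    1<t = s≤s (*-mono-≤ {1} {2} (s≤s z≤n) 1≤g)
    w≡ : ∀ g → 5 + 4 * g ≡ 3 + 2 * (1 + 2 * g)
    w≡ = solve-∀
    w-odd : 2 ∤ w
    w-odd = subst (2 ∤_) (eq g) (odd-∤-double (2 + 2 * g))
      where
      eq : ∀ g → 1 + 2 * (2 + 2 * g) ≡ 5 + 4 * g
      eq = solve-∀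
    bound : f x * (t * (3 + 2 * t)) ≤ 2 * ((1 + t) * (1 + t)) * x
    bound = subst (λ w → f x * (t * w) ≤ 2 * ((1 + t) * (1 + t)) * x) (w≡ g)
      (upper-bound {A = t * w} {2 * ((1 + t) * (1 + t))} 1≤M fy≡ (trans (cong (2 *_) fx≡) (eq g M)))
      where
      eq : ∀ g M → 2 * (4 * ((1 + g) * (1 + g)) * M) ≡ 2 * ((1 + (1 + 2 * g)) * (1 + (1 + 2 * g))) * M
      eq = solve-∀
    conclude : (Prime t × ∃ λ m → x ≡ t * t * m × t ∤ m × f x ≡ (1 + t * t) * f m) → ⊥
    conclude (pt , x₁ , x≡ , t∤x₁ , fx₁) = finish
      (squares-only (∤⇒positive t∤x₁) (s≤s (s≤s z≤n)) w∣x₁ small)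
      where
      1≤x₁ = ∤⇒positive t∤x₁
      t∤w : t ∤ w
      t∤w t∣w with prime-∣-3+2* pt (subst (t ∣_) (w≡ g) t∣w)
      ... | t≡3 with *-cancelˡ-≡ g 1 2 (suc-injective t≡3)
      -- Now `t = 3` and `w = 9`, so `27 * f M = 2 * 9 * x₁` and 3 divides `2 * x₁`, against
      -- `t ∤ x₁`.
      ... | refl = [ from-no (3 ∣? 2) , t∤x₁ ]′ (euclidsLemma 2 x₁ prime[3] (divides-by (f M)
              (*-cancelˡ-≡ _ _ 9 (trans (eq x₁) (trans (cong (2 *_) (sym x≡)) (trans (sym fy≡) (eq′ (f M))))))))
        where
        eq : ∀ x → 9 * (2 * x) ≡ 2 * (9 * x)
        eq = solve-∀
        eq′ : ∀ F → 27 * F ≡ 9 * (F * 3)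
        eq′ = solve-∀
      w∣x₁ : ∀ {p} → Prime p → p ∣ w → p ∣ x₁
      w∣x₁ {p} pp p∣w with euclidsLemma (t * t) x₁ pp (subst (p ∣_) x≡
           (odd-prime-∣-double w-odd pp p∣w (subst (p ∣_) fy≡ (∣m⇒∣m*n (f M) (∣n⇒∣m*n t p∣w)))))
      ... | inj₂ p∣x₁ = p∣x₁
      ... | inj₁ p∣tt with prime-∣-prime pp pt ([ (λ p∣t → p∣t) , (λ p∣t → p∣t) ]′ (euclidsLemma t t pp p∣tt))
      ... | refl = contradiction p∣w t∤w
      V = 2 * ((1 + t) * (1 + t)) * (t * t)
      bound₁ : f x₁ * ((1 + t * t) * (t * (3 + 2 * t))) ≤ V * x₁
      bound₁ = ≤-trans (≤-reflexive (trans (eq₁ (f x₁) (1 + t * t) (t * (3 + 2 * t)))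
          (cong (_* (t * (3 + 2 * t))) (sym fx₁))))
        (≤-trans bound (≤-reflexive (trans (cong (2 * ((1 + t) * (1 + t)) *_) x≡)
          (sym (*-assoc (2 * ((1 + t) * (1 + t))) (t * t) x₁)))))
        where
        eq₁ : ∀ a b c → a * (b * c) ≡ b * a * c
        eq₁ = solve-∀
      -- Once `t * t` has used up its share `1 + 1/(t * t)`, the bound left for `x₁` lies below
      -- `1 + 1/w`; the margin is the term `s * (4 * t)`.
      small : ∀ {s} → 1 ≤ s → s ≤ w → (1 + s) * x₁ ≰ s * f x₁
      small {s} 1≤s s≤w lower = <⇒≱ (begin-strict
        s * (2 * ((1 + t) * (1 + t)) * (t * t))
          <⟨ m<m+n _ (*-mono-≤ 1≤s (*-mono-≤ {1} {4} {1} {t} (s≤s z≤n) (s≤s z≤n))) ⟩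
        s * (2 * ((1 + t) * (1 + t)) * (t * t)) + s * (4 * t)    ≡⟨ eq₁ s t ⟩
        s * (1 + (3 + 2 * t)) * ((1 + t * t) * t)
          ≤⟨ *-monoˡ-≤ ((1 + t * t) * t) (suc-*-≤ (subst (s ≤_) (w≡ g) s≤w)) ⟩
        (1 + s) * (3 + 2 * t) * ((1 + t * t) * t)       ≡⟨ eq₂ s t ⟩
        (1 + s) * ((1 + t * t) * (t * (3 + 2 * t)))     ∎)
        (ratio-≤ {s} {x₁} {f x₁} {(1 + t * t) * (t * (3 + 2 * t))} {V} 1≤x₁ lower bound₁)
        where
        open ≤-Reasoning
        eq₁ : ∀ s t → s * (2 * ((1 + t) * (1 + t)) * (t * t)) + s * (4 * t) ≡ s * (1 + (3 + 2 * t)) * ((1 + t * t) * t)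
        eq₁ = solve-∀
        eq₂ : ∀ s t → (1 + s) * (3 + 2 * t) * ((1 + t * t) * t) ≡ (1 + s) * ((1 + t * t) * (t * (3 + 2 * t)))
        eq₂ = solve-∀
      finish : (Prime w × ∃ λ m → x₁ ≡ w * w * m × w ∤ m × f x₁ ≡ (1 + w * w) * f m) → ⊥
      finish (_ , x₂ , _ , _ , fx₂) = D∤E 1≤g
        (prime-powers-∣ pq M-power D≤E D∣M E∣M)
        where
        D E : ℕ
        D = 1 + 2 * g * (1 + g)
        E = 13 + 20 * g + 8 * (g * g)
        -- `1 + t * t = 2 * D` and `1 + w * w = 2 * E`, and the resulting 4 cancels against the one
        -- in `f x`.
        DE≡ : D * E * f x₂ ≡ (1 + g) * (1 + g) * M
        DE≡ = *-cancelˡ-≡ _ _ 4 (trans (eq₁ g (f x₂))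
          (trans (cong ((1 + t * t) *_) (sym fx₂)) (trans (sym fx₁) (trans fx≡ (eq₂ g M)))))
          where
          eq₁ : ∀ g F → 4 * ((1 + 2 * g * (1 + g)) * (13 + 20 * g + 8 * (g * g)) * F) ≡
                (1 + (1 + 2 * g) * (1 + 2 * g)) * ((1 + (5 + 4 * g) * (5 + 4 * g)) * F)
          eq₁ = solve-∀
          eq₂ : ∀ g M → 4 * ((1 + g) * (1 + g)) * M ≡ 4 * ((1 + g) * (1 + g) * M)
          eq₂ = solve-∀
        -- `D` and `E` are both 1 modulo `1 + g`, so they divide `M` itself.
        coprime-Q : ∀ {d c} → d ≡ c * (1 + g) + 1 → Coprime d (1 + g)
        coprime-Q {d} {c} refl (i∣d , i∣Q) = ∣1⇒≡1 (∣m+n∣m⇒∣n i∣d (∣n⇒∣m*n c i∣Q))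
        coprime-Q-∣ : ∀ {d} → Coprime d (1 + g) → d ∣ (1 + g) * (1 + g) * M → d ∣ M
        coprime-Q-∣ d⊥Q d∣ = coprime-divisor (coprime-* d⊥Q d⊥Q) d∣
        D∣M : D ∣ M
        D∣M = coprime-Q-∣ (coprime-Q {D} {2 * g} (+-comm 1 (2 * g * (1 + g))))
          (subst (D ∣_) DE≡ (∣m⇒∣m*n (f x₂) (m∣m*n E)))
        E∣M : E ∣ M
        E∣M = coprime-Q-∣ (coprime-Q {E} {12 + 8 * g} (eq g))
          (subst (E ∣_) DE≡ (∣m⇒∣m*n (f x₂) (n∣m*n D)))
          where
          eq : ∀ g → 13 + 20 * g + 8 * (g * g) ≡ (12 + 8 * g) * (1 + g) + 1
          eq = solve-∀
        D≤E : D ≤ E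
        D≤E = ≤-trans (m≤m+n D (12 + 18 * g + 6 * (g * g))) (≤-reflexive (eq g))
          where
          eq : ∀ g → 1 + 2 * g * (1 + g) + (12 + 18 * g + 6 * (g * g)) ≡ 13 + 20 * g + 8 * (g * g)
          eq = solve-∀
        1<D : 1 < D
        1<D = s≤s (*-mono-≤ {1} {2 * g} {1} (*-mono-≤ {1} {2} (s≤s z≤n) 1≤g) (s≤s z≤n))
        q,pq,q∣D = prime-divisor 1<D
        q = proj₁ q,pq,q∣D
        pq = proj₁ (proj₂ q,pq,q∣D)
        M-power : PowerOf q M
        M-power = prime-power-if-4∤ pq 2∤M
          (λ 4∣fM → 2∤x⇒4∤2x 2∤x (subst (4 ∣_) fy≡ (∣n⇒∣m*n (t * w) 4∣fM)))
          (∣-trans (proj₂ (proj₂ q,pq,q∣D)) D∣M)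

  -- Odd `x` with `f x` exactly divisible by 2 or by 4

  -- `f 2 = 3` puts 3 into `x`. If `x = 9 * m` with `3 ∤ m`, then `M = 5 * f m` is odd, which forces
  -- `m = 1`. Otherwise `h(x) ≥ 4/3` yields `f M ≤ M`, so `M = 1`, and `3 = 2 * x` is absurd.
  exponent-one-case : ∀ {x M} → 2 ∤ x → 2 ∤ M → 3 * f M ≡ 2 * x → f x ≡ 2 * M → x ≡ 9
  exponent-one-case {x} {M} 2∤x 2∤M fy≡ fx≡
    with local prime[3] (∤⇒positive 2∤x) (odd-prime-∣-double {3} {3} (from-no (2 ∣? 3)) prime[3] ∣-refl
           (subst (3 ∣_) fy≡ (m∣m*n (f M))))
  ... | square m x≡ 3∤m fx₁ with f-even-cofactor (∤⇒positive 3∤m)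
    (λ 2∣m → 2∤x (subst (2 ∣_) (sym x≡) (∣n⇒∣m*n 9 2∣m)))
  ... | inj₁ refl = x≡
  ... | inj₂ 2∣fm = contradiction (subst (2 ∣_) (sym M≡) (∣n⇒∣m*n 5 2∣fm)) 2∤M
    where
    eq : ∀ F → 2 * (5 * F) ≡ 10 * F
    eq = solve-∀
    M≡ : M ≡ 5 * f m
    M≡ = *-cancelˡ-≡ _ _ 2 (trans (sym fx≡) (trans fx₁ (sym (eq (f m)))))
  exponent-one-case {x} {M} 2∤x 2∤M fy≡ fx≡ | large lower with m≤n⇒m<n∨m≡n (∤⇒positive 2∤M)
  ... | inj₂ refl = contradiction (subst (2 ∣_) (trans (sym fy≡) (cong (3 *_) f-1)) (m∣m*n x)) (from-no (2 ∣? 3))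
  ... | inj₁ 1<M = contradiction (*-cancelˡ-≤ 6 (begin
      6 * f M           ≡⟨ eq₁ (f M) ⟩
      2 * (3 * f M)     ≡⟨ cong (2 *_) fy≡ ⟩
      2 * (2 * x)       ≡⟨ *-assoc 2 2 x ⟨
      4 * x             ≤⟨ lower ⟩
      3 * f x           ≡⟨ cong (3 *_) fx≡ ⟩
      3 * (2 * M)       ≡⟨ *-assoc 3 2 M ⟨
      6 * M             ∎)) (<⇒≱ (f-increasing M 1<M))
    where
    open ≤-Reasoning
    eq₁ : ∀ F → 6 * F ≡ 2 * (3 * F)
    eq₁ = solve-∀

  -- For `k ≥ 1` the sum `geom 3 (suc k)` has a prime divisor, which divides `2 * x` and so is 2 or
  -- 5; the residues modulo 20 exclude both, since `4 ∤ f M`. Of the remaining `M`, 3 has `f 3 = 4`,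
  -- and 9 survives.
  prime-power-of-3 : ∀ {x M e} → PowerOf 3 M → 4 ∤ f M → x ≡ 5 ^ e → 5 * f M ≡ 2 * x → M ≡ 9 × x ≡ 25
  prime-power-of-3 (power-of {zero} odd-exponent refl) 4∤fM _ _ =
    contradiction (subst (4 ∣_) (sym (f-prime-power {k = 0} prime[3] odd-exponent)) ∣-refl) 4∤fM
  prime-power-of-3 {x} (power-of {zero} even-exponent refl) _ _ fy≡ =
    refl , sym (*-cancelˡ-≡ 25 x 2 (trans (cong (5 *_) (sym (f-prime-power {k = 0} prime[3] even-exponent))) fy≡))
  prime-power-of-3 {x} {M} {e} (power-of {suc k} {j} kj refl) 4∤fM x≡ fy≡
    with prime-divisor (1<geom 3 k (s≤s z≤n))
  ... | r , pr , r∣G with euclidsLemma 2 x pr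
    (subst (r ∣_) fy≡ (∣n⇒∣m*n 5 (subst (r ∣_) (sym fM≡) (∣m⇒∣m*n (1 + 3 ^ j) r∣G))))
    where
    fM≡ = f-prime-power prime[3] kj
  ... | inj₁ r∣2 with refl ← prime-∣-prime pr prime[2] r∣2 =
          contradiction r∣G (proj₁ (geom-3-prime-factors (2 + k)
          λ 4∣G → 4∤fM (subst (4 ∣_) (sym (f-prime-power prime[3] kj)) (∣m⇒∣m*n (1 + 3 ^ j) 4∣G))))
  ... | inj₂ r∣x with refl ← prime-∣-prime pr prime[5] (prime-∣-^ 5 e pr (subst (r ∣_) x≡ r∣x)) =
          contradiction r∣G (proj₂ (geom-3-prime-factors (2 + k)
          λ 4∣G → 4∤fM (subst (4 ∣_) (sym (f-prime-power prime[3] kj)) (∣m⇒∣m*n (1 + 3 ^ j) 4∣G))))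

  -- The case `x = 5 * m`, where `f 5 = 6`. Unless `M = 9`, `h(M) ≥ 4/3` yields `f m ≤ m`; and
  -- `M = 9` gives `m = 5`.
  power-case-6 : ∀ {m M} → 1 < m → 5 ∤ m → PowerOf 3 M → 3 * f m ≡ 2 * M → f M ≡ 2 * m → ⊥
  power-case-6 {m} {M} 1<m 5∤m (power-of {k} {j} kj refl) fm≡ fM≡ with σ-local-lower 3 kj
  ... | inj₁ (refl , refl) = 5∤m (divides-by 1 (sym
          (*-cancelˡ-≡ 5 m 2 (trans (sym (f-prime-power {k = 0} prime[3] even-exponent)) fM≡))))
  ... | inj₂ lower = <⇒≱ (f-increasing m 1<m) (*-cancelˡ-≤ 6 (begin
      6 * f m                 ≡⟨ eq₁ (f m) ⟩
      2 * (3 * f m)           ≡⟨ cong (2 *_) fm≡ ⟩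
      2 * (2 * M)             ≡⟨ *-assoc 2 2 M ⟨
      4 * M                   ≤⟨ lower ⟩
      3 * σ-local 3 k j       ≡⟨ cong (3 *_) (trans (sym (f-prime-power prime[3] kj)) fM≡) ⟩
      3 * (2 * m)             ≡⟨ *-assoc 3 2 m ⟨
      6 * m                   ∎))
    where
    open ≤-Reasoning
    eq₁ : ∀ F → 6 * F ≡ 2 * (3 * F)
    eq₁ = solve-∀

  -- The case `x = 25 * m`, where `f 25 = 26`. The equations say `h(m) h(M) = 20/13`, and
  -- `h(M) ≤ 13/12`, so `h(m) ≥ 240/169`. Only powers of 3 reach this among powers of odd primes,
  -- and then `1 + 13 ^ j′`, which is prime to 3, divides `10 * m`.
  power-case-26 : ∀ {m M p} → Prime p → 2 ∤ m → p ∣ m → PowerOf p m → PowerOf 13 M →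
                  13 * f m ≡ 2 * M → f M ≡ 10 * m → ⊥
  power-case-26 {m} {M} {zero} pp = contradiction pp ¬prime[0]
  power-case-26 {m} {M} {suc r} pp 2∤m p∣m (power-of {k} {j} kj m≡) (power-of {k′} {j′} kj′ refl) fm≡ fM≡
    = contradiction H∣10 (>⇒∤ 10<H)
    where
    open ≤-Reasoning
    1≤m = ∤⇒positive 2∤m
    H = 1 + 13 ^ j′
    10<H : 10 < H
    10<H = ≤-trans (from-yes (11 ≤? 14)) (s≤s (^-monoʳ-≤ 13 {1} (exponents-1≤j kj′)))
    240m≤169fm : 240 * m ≤ 169 * f m
    240m≤169fm = begin
      240 * m                        ≡⟨ eq₁ m ⟩
      2 * (12 * (10 * m))            ≡⟨ cong (λ y → 2 * (12 * y)) (trans (sym fM≡) (f-prime-power prime[13] kj′)) ⟩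
      2 * (12 * σ-local 13 k′ j′)    ≤⟨ *-monoʳ-≤ 2 (σ-local-upper 12 kj′) ⟩
      2 * (13 * M)                   ≡⟨ eq₂ M ⟩
      13 * (2 * M)                   ≡⟨ cong (13 *_) fm≡ ⟨
      13 * (13 * f m)                ≡⟨ *-assoc 13 13 (f m) ⟨
      169 * f m                      ∎
      where
      eq₁ : ∀ m → 240 * m ≡ 2 * (12 * (10 * m))
      eq₁ = solve-∀
      eq₂ : ∀ m → 2 * (13 * m) ≡ 13 * (2 * m)
      eq₂ = solve-∀
    240r≤169p : r * 240 ≤ 169 * suc r
    240r≤169p = *-cancelʳ-≤ (r * 240) (169 * suc r) m {{>-nonZero 1≤m}} (begin
      r * 240 * m                    ≡⟨ *-assoc r 240 m ⟩
      r * (240 * m)                  ≤⟨ *-monoʳ-≤ r 240m≤169fm ⟩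
      r * (169 * f m)                ≡⟨ eq₁ r 169 (f m) ⟩
      169 * (r * f m)                ≡⟨ cong (λ y → 169 * (r * y)) (trans (cong f m≡) (f-prime-power pp kj)) ⟩
      169 * (r * σ-local (suc r) k j)     ≤⟨ *-monoʳ-≤ 169 (σ-local-upper r kj) ⟩
      169 * (suc r * suc r ^ (k + j))     ≡⟨ cong (λ y → 169 * (suc r * y)) m≡ ⟨
      169 * (suc r * m)              ≡⟨ *-assoc 169 (suc r) m ⟨
      169 * suc r * m                ∎)
      where
      eq₁ : ∀ a b c → a * (b * c) ≡ b * (a * c)
      eq₁ = solve-∀
    -- `p / (p - 1) ≥ 240 / 169` amounts to `71 * r ≤ 169`.
    r≤2 : r ≤ 2
    r≤2 = ≮⇒≥ λ 3≤r → contradiction (begin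
      71 * 3            ≤⟨ *-monoʳ-≤ 71 3≤r ⟩
      71 * r            ≤⟨ +-cancelˡ-≤ (169 * r) (71 * r) 169
                           (≤-trans (≤-reflexive (eq₁ r)) (≤-trans 240r≤169p (≤-reflexive (eq₂ r)))) ⟩
      169               ∎) (from-no (213 ≤? 169))
      where
      eq₁ : ∀ r → 169 * r + 71 * r ≡ r * 240
      eq₁ = solve-∀
      eq₂ : ∀ r → 169 * (1 + r) ≡ 169 * r + 169
      eq₂ = solve-∀
    small-odd-prime : ∀ r → r ≤ 2 → Prime (suc r) → 2 ∤ suc r → suc r ≡ 3
    small-odd-prime 0 _ p1 _ = contradiction p1 ¬prime[1]
    small-odd-prime 1 _ _ 2∤2 = contradiction ∣-refl 2∤2
    small-odd-prime 2 _ _ _ = refl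
    small-odd-prime (suc (suc (suc _))) (s≤s (s≤s ())) _ _
    m≡3^ : m ≡ 3 ^ (k + j)
    m≡3^ = trans m≡ (cong (_^ (k + j)) (small-odd-prime r r≤2 pp (λ 2∣p → 2∤m (∣-trans 2∣p p∣m))))
    3∤H : 3 ∤ H
    3∤H 3∣H = from-no (3 ∣? 2) (∣-remainder (geom 13 j′) 12 2 (divides-by 4 refl)
      (trans (cong suc (sym (geom-closed 12 j′))) (eq (geom 13 j′))) 3∣H)
      where
      eq : ∀ g → 1 + (12 * g + 1) ≡ g * 12 + 2
      eq = solve-∀
    H∣10 : H ∣ 10
    H∣10 = coprime-divisor (Coprimality.sym (coprime-^ (k + j) (prime-∤⇒coprime prime[3] 3∤H)))
      (subst (H ∣_) (trans (sym (f-prime-power prime[13] kj′))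
        (trans fM≡ (trans (cong (10 *_) m≡3^) (*-comm 10 (3 ^ (k + j))))))
        (n∣m*n (geom 13 (suc k′))))

  -- The case `m = 1`. As `h` is odd, `G` is even and hence divisible by 6, so `M` is a power of 3.
  -- That leaves `M = 9` and `x = 25`, but `f 25 = 26` is not `4 * 9`.
  pure-power-of-5 : ∀ {x M G h e} → 2 ∤ x → 2 ∤ M → 4 ∤ f M → 6 ∣ G ⊎ (∃ λ c → G ≡ c * 6 + 1) → 2 ∤ h →
                    G * h ≡ 2 * M → x ≡ 5 ^ e → 5 * f M ≡ 2 * x → f x ≡ 4 * M → ⊥
  pure-power-of-5 {x} {M} {G} {h} _ _ _ (inj₂ (c , G≡)) 2∤h Gh≡ _ _ _ =
    [ from-no (2 ∣? 1) ∘ ∣-remainder c 6 1 (divides-by 3 refl) G≡ , 2∤h ]′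
      (euclidsLemma G h prime[2] (subst (2 ∣_) (sym Gh≡) (m∣m*n M)))
  pure-power-of-5 {x} {M} {G} {h} {e} 2∤x 2∤M 4∤fM (inj₁ 6∣G) _ Gh≡ x≡ fy≡ fx≡ = twenty-five
    (prime-power-of-3 {e = e} (prime-power-if-4∤ prime[3] 2∤M 4∤fM 3∣M) 4∤fM x≡ fy≡)
    where
    3∣M : 3 ∣ M
    3∣M = odd-prime-∣-double {3} {3} (from-no (2 ∣? 3)) prime[3] ∣-refl
      (subst (3 ∣_) Gh≡ (∣m⇒∣m*n h (∣-trans (divides-by 2 refl) 6∣G)))
    twenty-five : M ≡ 9 × x ≡ 25 → ⊥
    twenty-five (M≡9 , x≡25) = from-no (26 ≟ 36) (begin
      26        ≡⟨ f-prime-power {k = 0} prime[5] even-exponent ⟨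
      f 25      ≡⟨ cong f x≡25 ⟨
      f x       ≡⟨ fx≡ ⟩
      4 * M     ≡⟨ cong (4 *_) M≡9 ⟩
      36        ∎)
      where open ≡-Reasoning

  -- `G` and `h` exceed 1 and divide the prime power `M`, so they share its prime, which divides 6.
  -- It is not 2 because `M` is odd, and not 3 because an odd `G` is 1 modulo 6.
  large-exponent-of-5 : ∀ {M G h F} → 2 ∤ M → 4 ∤ f M → 6 ∣ G ⊎ (∃ λ c → G ≡ c * 6 + 1) →
                        1 < G → 1 < h → G * h * F ≡ M → (∀ {q} → q ∣ G → q ∣ h → q ∣ 6) → ⊥
  large-exponent-of-5 {M} {G} {h} {F} 2∤M 4∤fM G-mod-6 1<G 1<h GhF≡M gcd∣6
    with prime-divisor 1<G | prime-divisor 1<h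
  ... | q , pq , q∣G | r , pr , r∣h = conclude (prime-power-if-4∤ pq 2∤M 4∤fM (∣-trans q∣G G∣M))
    where
    G∣M : G ∣ M
    G∣M = subst (G ∣_) GhF≡M (∣m⇒∣m*n F (m∣m*n h))
    h∣M : h ∣ M
    h∣M = subst (h ∣_) GhF≡M (∣m⇒∣m*n F (n∣m*n G))
    3∤G : 3 ∤ G
    3∤G = [ (λ 6∣G → contradiction (∣-trans (∣-trans (divides-by 3 refl) 6∣G) G∣M) 2∤M)
          , (λ (c , G≡) → from-no (3 ∣? 1) ∘ ∣-remainder c 6 1 (divides-by 2 refl) G≡) ]′ G-mod-6
    conclude : PowerOf q M → ⊥
    conclude (power-of {k} {j} _ M≡)
      with refl ← prime-∣-prime pr pq (prime-∣-^ q (k + j) pr (subst (r ∣_) M≡ (∣-trans r∣h h∣M)))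
      with euclidsLemma 2 3 pq (gcd∣6 q∣G r∣h)
    ... | inj₁ q∣2 with refl ← prime-∣-prime pq prime[2] q∣2 = 2∤M (∣-trans q∣G G∣M)
    ... | inj₂ q∣3 with refl ← prime-∣-prime pq prime[3] q∣3 = 3∤G q∣G


  -- G and h stand for geom 5 (suc k) and (1 + 5 ^ j) / 2, as variables so that products do not unfold.
  exponent-two-split : ∀ {x M m k j} G h → 2 ∤ x → 2 ∤ M → 5 * f M ≡ 2 * x → f x ≡ 4 * M →
    5 ∤ m → Exponents k j → G ≡ geom 5 (suc k) → 2 * h ≡ 1 + 5 ^ j → 2 ∤ h →
    x ≡ 5 ^ (k + j) * m → f x ≡ G * (1 + 5 ^ j) * f m → ⊥
  exponent-two-split {x} {M} {m} {k} {j} G h 2∤x 2∤M fy≡ fx≡ 5∤m kj G≡ 2h≡ 2∤h x≡ fx≡GHf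
    with f-even-cofactor (∤⇒positive 5∤m) 2∤m
    where
    2∤m : 2 ∤ m
    2∤m 2∣m = 2∤x (subst (2 ∣_) (sym x≡) (∣n⇒∣m*n (5 ^ (k + j)) 2∣m))
  ... | m≡1⊎2∣fm = rest (m≤n⇒m<n∨m≡n (∤⇒positive 5∤m))
    where
    4∤fM : 4 ∤ f M
    4∤fM 4∣fM = 2∤x⇒4∤2x 2∤x (subst (4 ∣_) fy≡ (∣n⇒∣m*n 5 4∣fM))
    G-mod-6 : 6 ∣ G ⊎ ∃ λ c → G ≡ c * 6 + 1
    G-mod-6 = subst (λ G → 6 ∣ G ⊎ ∃ λ c → G ≡ c * 6 + 1) (sym G≡) (geom-5-mod-6 (suc k))
    Ghf≡2M : G * h * f m ≡ 2 * M
    Ghf≡2M = *-cancelˡ-≡ _ _ 2 (begin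
      2 * (G * h * f m)         ≡⟨ shuffle G h (f m) ⟩
      G * (2 * h) * f m         ≡⟨ cong (λ y → G * y * f m) 2h≡ ⟩
      G * (1 + 5 ^ j) * f m     ≡⟨ fx≡GHf ⟨
      f x                       ≡⟨ fx≡ ⟩
      4 * M                     ≡⟨ *-assoc 2 2 M ⟩
      2 * (2 * M)               ∎)
      where
      open ≡-Reasoning
      shuffle : ∀ G h F → 2 * (G * h * F) ≡ G * (2 * h) * F
      shuffle = solve-∀

    many : 1 < m → 2 ∣ f m → ⊥
    many 1<m (divides-by F fm≡) = by-exponent kj refl refl
      where
      GhF≡M : G * h * F ≡ M
      GhF≡M = *-cancelʳ-≡ _ _ 2 (trans (*-assoc (G * h) F 2)
        (trans (cong (G * h *_) (sym fm≡)) (trans Ghf≡2M (*-comm 2 M))))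
      h∣M : h ∣ M
      h∣M = subst (h ∣_) GhF≡M (∣m⇒∣m*n F (n∣m*n G))
      4∤fm : 4 ∤ f m
      4∤fm 4∣fm = 2∤M (subst (2 ∣_) GhF≡M (∣n⇒∣m*n (G * h) (*-cancelʳ-∣ 2 (subst (4 ∣_) fm≡ 4∣fm))))
      2∤m : 2 ∤ m
      2∤m 2∣m = 2∤x (subst (2 ∣_) (sym x≡) (∣n⇒∣m*n (5 ^ (k + j)) 2∣m))
      p,pp,p∣m = prime-divisor 1<m
      pp = proj₁ (proj₂ p,pp,p∣m)
      p∣m = proj₂ (proj₂ p,pp,p∣m)
      M-power : ∀ {q} → Prime q → q ∣ h → PowerOf q M
      M-power pq q∣h = prime-power-if-4∤ pq 2∤M 4∤fM (∣-trans q∣h h∣M)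

      fM≡ : ∀ c d → 2 * c ≡ 5 * d → x ≡ c * m → f M ≡ d * m
      fM≡ c d 2c≡5d x≡cm = *-cancelˡ-≡ (f M) (d * m) 5 (begin
        5 * f M        ≡⟨ fy≡ ⟩
        2 * x          ≡⟨ cong (2 *_) x≡cm ⟩
        2 * (c * m)    ≡⟨ *-assoc 2 c m ⟨
        2 * c * m      ≡⟨ cong (_* m) 2c≡5d ⟩
        5 * d * m      ≡⟨ *-assoc 5 d m ⟩
        5 * (d * m)    ∎)
        where open ≡-Reasoning

      by-exponent : ∀ {k′ j′} → Exponents k′ j′ → k′ ≡ k → j′ ≡ j → ⊥
      by-exponent {zero} odd-exponent refl refl = power-case-6 1<m 5∤m
        (M-power prime[3] (∣-reflexive (sym h≡3)))
        (trans (cong (_* f m) (sym (cong₂ _*_ G≡ h≡3))) Ghf≡2M) (fM≡ 5 2 refl x≡)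
        where
        h≡3 : h ≡ 3
        h≡3 = *-cancelˡ-≡ h 3 2 2h≡
      by-exponent {zero} even-exponent refl refl = power-case-26 pp 2∤m p∣m
        (prime-power-if-4∤ pp 2∤m 4∤fm p∣m) (M-power prime[13] (∣-reflexive (sym h≡13)))
        (trans (cong (_* f m) (sym (cong₂ _*_ G≡ h≡13))) Ghf≡2M) (fM≡ 25 10 refl x≡)
        where
        h≡13 : h ≡ 13
        h≡13 = *-cancelˡ-≡ h 13 2 2h≡
      by-exponent {suc k″} ex refl refl = large-exponent-of-5 2∤M 4∤fM G-mod-6
        (subst (1 <_) (sym G≡) (1<geom 5 k″ (s≤s z≤n))) 1<h GhF≡M (gcd∣6 ex refl)
        where
        1<h : 1 < h
        1<h = *-cancelˡ-< 2 1 h (subst (2 <_) (sym 2h≡)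
          (s≤s (≤-trans (from-yes (2 ≤? 5)) (^-monoʳ-≤ 5 {1} (exponents-1≤j kj)))))
        X≡ : 4 * G + 1 ≡ 5 ^ suc k
        X≡ = trans (cong (λ G → 4 * G + 1) G≡) (geom-closed 4 (suc k))
        gcd∣6 : ∀ {j′} → Exponents k j′ → j′ ≡ j → ∀ {q} → q ∣ G → q ∣ h → q ∣ 6
        gcd∣6 odd-exponent  refl q∣G q∣h =
          ∣-trans (common-divisor {r = 1} 2h≡ X≡ (sym (*-identityˡ _)) q∣G q∣h) (divides-by 3 refl)
        gcd∣6 even-exponent refl q∣G q∣h = common-divisor {r = 5} 2h≡ X≡ refl q∣G q∣h

    rest : 1 < m ⊎ 1 ≡ m → ⊥
    rest (inj₁ 1<m) = [ (λ m≡1 → contradiction (sym m≡1) (<⇒≢ 1<m)) , many 1<m ]′ m≡1⊎2∣fm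
    rest (inj₂ 1≡m) = pure-power-of-5 {e = k + j} 2∤x 2∤M 4∤fM G-mod-6 2∤h
      (trans (sym (trans (cong (λ m → G * h * f m) (sym 1≡m))
        (trans (cong (G * h *_) f-1) (*-identityʳ (G * h))))) Ghf≡2M)
      (trans x≡ (trans (cong (5 ^ (k + j) *_) (sym 1≡m)) (*-identityʳ (5 ^ (k + j))))) fy≡ fx≡

  -- `f 4 = 5` puts 5 into `x`. Since `5 ^ j` is 1 modulo 4, half of `1 + 5 ^ j` is the odd number
  -- `1 + 2 * geom 5 j`.
  exponent-two-case : ∀ {x M} → 2 ∤ x → 2 ∤ M → 5 * f M ≡ 2 * x → f x ≡ 4 * M → ⊥
  exponent-two-case {x} {M} 2∤x 2∤M fy≡ fx≡
    with part-of prime[5] (∤⇒positive 2∤x) (odd-prime-∣-double {5} {5} (from-no (2 ∣? 5)) prime[5] ∣-refl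
           (subst (5 ∣_) fy≡ (m∣m*n (f M))))
  ... | part {k} {j} kj m x≡ 5∤m fx≡GHf = exponent-two-split (geom 5 (suc k)) (1 + 2 * geom 5 j)
    2∤x 2∤M fy≡ fx≡ 5∤m kj refl (trans (double (geom 5 j)) (cong suc (geom-closed 4 j)))
    (odd-∤-double (geom 5 j)) x≡ fx≡GHf
    where
    double : ∀ g → 2 * (1 + 2 * g) ≡ 1 + (4 * g + 1)
    double = solve-∀

  -- Both 2-parts equal to 4

  -- The exact product of the quotients of `u` and `v` is `β / α`, a budget that lower bounds
  -- `a / b` and `c / d` must respect; each application ends in a false comparison of numerals.
  over-budget : ∀ {α β u v a b c d} → 1 ≤ u → 1 ≤ v → α * (f u * f v) ≡ β * (u * v) →
                a * u ≤ b * f u → c * v ≤ d * f v → α * (a * c) ≤ b * d * β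
  over-budget {α} {β} {u} {v} {a} {b} {c} {d} 1≤u 1≤v eq au≤ cv≤ =
    *-cancelʳ-≤ (α * (a * c)) (b * d * β) (u * v) {{>-nonZero (*-mono-≤ 1≤u 1≤v)}} (begin
      α * (a * c) * (u * v)       ≡⟨ *-assoc α (a * c) (u * v) ⟩
      α * (a * c * (u * v))       ≤⟨ *-monoʳ-≤ α (*-bounds {a} {b} {c} {d} au≤ cv≤) ⟩
      α * (b * d * (f u * f v))   ≡⟨ swap α (b * d) (f u * f v) ⟩
      b * d * (α * (f u * f v))   ≡⟨ cong (b * d *_) eq ⟩
      b * d * (β * (u * v))       ≡⟨ *-assoc (b * d) β (u * v) ⟨
      b * d * β * (u * v)         ∎)
    where
    open ≤-Reasoning
    swap : ∀ x y z → x * (y * z) ≡ y * (x * z)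
    swap = solve-∀

  scaled-bound : ∀ {n} a b c d P S m → n ≡ P * m → f n ≡ S * f m →
                 a * P ≤ b * S → c * m ≤ d * f m → a * c * n ≤ b * d * f n
  scaled-bound a b c d P S m n≡ fn≡ aP≤bS cm≤dfm = subst₂ (λ n F → a * c * n ≤ b * d * F) (sym n≡) (sym fn≡)
    (*-bounds {a} {b} {c} {d} {P} {m} {S} {f m} aP≤bS cm≤dfm)

  -- The power `P` of 5 and its value `S` become variables, so that products with them do not
  -- unfold; the consequences needed of `P` being a power of 5 are fields.
  data FivePart (n : ℕ) : Set where
    twenty-five : ∀ m → n ≡ 25 * m → f n ≡ 26 * f m → FivePart n
    large-part  : ∀ P S m → n ≡ P * m → f n ≡ S * f m → 5 ∤ m →
                  (∀ {p n} → Prime p → p ∤ 5 → p ∣ P * n → p ∣ n) → 2 ∣ S →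
                  6 * P ≤ 5 * S → FivePart n

  five-part : ∀ {n} → 1 ≤ n → 5 ∣ n → FivePart n
  five-part 1≤n 5∣n with part-of prime[5] 1≤n 5∣n
  ... | part {k} {j} kj m n≡ 5∤m fn≡ =
    [ (λ (k≡0 , j≡2) → twenty-five m
        (trans n≡ (cong (λ e → 5 ^ e * m) (cong₂ _+_ k≡0 j≡2)))
        (trans fn≡ (cong (_* f m) (cong₂ (σ-local 5) k≡0 j≡2))))
    , large-part (5 ^ (k + j)) (σ-local 5 k j) m n≡ fn≡ 5∤m
        (prime-∣-^* (k + j)) (σ-local-even {5} k j (from-no (2 ∣? 5))) ]′ (σ-local-lower 5 kj)

  -- The case x = 4 u and f x = 4 v.
  module FourFour {u v : ℕ} (2∤u : 2 ∤ u) (2∤v : 2 ∤ v)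
                  (fu≡ : 5 * f u ≡ 4 * v) (fv≡ : 5 * f v ≡ 8 * u) where

    1≤u = ∤⇒positive 2∤u
    1≤v = ∤⇒positive 2∤v

    -- The budget is `32 / 25`, already below the `36 / 25` that two large parts at 5 would cost.
    product≡ : 25 * (f u * f v) ≡ 32 * (u * v)
    product≡ = trans (interchange 5 5 (f u) (f v)) (trans (cong₂ _*_ fu≡ fv≡) (eq u v))
      where
      eq : ∀ u v → 4 * v * (8 * u) ≡ 32 * (u * v)
      eq = solve-∀

    8∤4v : 8 ∤ 4 * v
    8∤4v 8∣4v = 2∤v (*-cancelˡ-∣ 4 8∣4v)

    odd-factor : ∀ {n} a {b} → 2 ∤ n → n ≡ a * b → 2 ∤ b
    odd-factor a 2∤n refl 2∣b = 2∤n (∣n⇒∣m*n a 2∣b)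

    -- The factor 26 of `f u` sends 13 to `v`. The budget admits 13 only as a square, whose factor
    -- 170 sends 17 to `u`, again only as a square. The oddness of `v` then leaves `u″ = 1`, which
    -- determines `v`.
    case-25-large : ∀ {u′ v′ P S} → u ≡ 25 * u′ → f u ≡ 26 * f u′ →
      v ≡ P * v′ → f v ≡ S * f v′ → 5 ∤ v′ →
      (∀ {p n} → Prime p → p ∤ 5 → p ∣ P * n → p ∣ n) →
      6 * P ≤ 5 * S → ⊥
    case-25-large {u′} {v′} {P} {S} u≡ fu≡′ v≡ fv≡′ 5∤v′ P-power lower = step₁₃ (local prime[13] 1≤v′ 13∣v′)
      where
      1≤u′ = cofactor-positive 25 1≤u u≡
      1≤v′ = ∤⇒positive 5∤v′
      4v≡ : 4 * v ≡ 130 * f u′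
      4v≡ = trans (sym fu≡) (trans (cong (5 *_) fu≡′) (sym (*-assoc 5 26 (f u′))))
      8u≡ : 8 * u ≡ 5 * (S * f v′)
      8u≡ = trans (sym fv≡) (cong (5 *_) fv≡′)
      13∣v′ : 13 ∣ v′
      13∣v′ = P-power prime[13] (from-no (13 ∣? 5)) (subst (13 ∣_) v≡
        (prime-∣-*ʳ 4 prime[13] (from-no (13 ∣? 4)) (subst (13 ∣_) (sym 4v≡) (∣-coefficient 130 (f u′)))))
      step₁₇ : ∀ {v″} → v′ ≡ 169 * v″ → Local 17 u′ → ⊥
      step₁₇ v′≡ (large lower₁₇) = contradiction
        (over-budget {25} {32} {u} {v} {26 * 18} {25 * 17} {6 * 1} {5 * 1} 1≤u 1≤v product≡
          (scaled-bound 26 25 18 17 25 26 u′ u≡ fu≡′ ≤-refl lower₁₇)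
          (scaled-bound 6 5 1 1 P S v′ v≡ fv≡′ lower (*-monoʳ-≤ 1 (≤f 1≤v′))))
        (from-no (25 * (26 * 18 * (6 * 1)) ≤? 25 * 17 * (5 * 1) * 32))
      step₁₇ {v″} v′≡ (square u″ u′≡ 17∤u″ fu′≡)
        with f-even-cofactor (∤⇒positive 17∤u″) (odd-factor 289 (odd-factor 25 2∤u u≡) u′≡)
      ... | inj₂ 2∣fu″ = 2∤v (subst (2 ∣_) (sym v≡9425) (∣n⇒∣m*n 9425 2∣fu″))
        where
        -- `9425 = 5 * 26 * 290 / 4 = 25 * 13 * 29`, which contains 13 only once.
        v≡9425 : v ≡ 9425 * f u″
        v≡9425 = *-cancelˡ-≡ _ _ 4 (trans 4v≡ (trans (cong (130 *_) fu′≡)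
          (trans (sym (*-assoc 130 290 (f u″))) (*-assoc 4 9425 (f u″)))))
      ... | inj₁ refl = from-no (169 ∣? 9425) (subst (169 ∣_) v≡9425 (subst (169 ∣_) (sym v≡)
              (∣n⇒∣m*n P (subst (169 ∣_) (sym v′≡) (m∣m*n v″)))))
        where
        v≡9425 : v ≡ 9425
        v≡9425 = *-cancelˡ-≡ _ _ 4 (trans 4v≡ (cong (130 *_) (trans fu′≡ (cong (290 *_) f-1))))
      step₁₃ : Local 13 v′ → ⊥
      step₁₃ (large lower₁₃) = contradiction
        (over-budget {25} {32} {u} {v} {26 * 1} {25 * 1} {6 * 14} {5 * 13} 1≤u 1≤v product≡
          (scaled-bound 26 25 1 1 25 26 u′ u≡ fu≡′ ≤-refl (*-monoʳ-≤ 1 (≤f 1≤u′)))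
          (scaled-bound 6 5 14 13 P S v′ v≡ fv≡′ lower lower₁₃))
        (from-no (25 * (26 * 1 * (6 * 14)) ≤? 25 * 1 * (5 * 13) * 32))
      step₁₃ (square v″ v′≡ _ fv′≡) = step₁₇ {v″} v′≡ (local prime[17] 1≤u′ 17∣u′)
        where
        17∣u′ : 17 ∣ u′
        17∣u′ = prime-∣-*ʳ 25 prime[17] (from-no (17 ∣? 25)) (subst (17 ∣_) u≡
          (prime-∣-*ʳ 8 prime[17] (from-no (17 ∣? 8)) (subst (17 ∣_) (sym 8u≡)
            (∣n⇒∣m*n 5 (∣n⇒∣m*n S (subst (17 ∣_) (sym fv′≡) (∣-coefficient 170 (f v″))))))))

    -- The same chain with the sides exchanged, but a different end: `S`, 170 and `f u″` cannot all
    -- be even because `8 ∤ 4 * v`, so `u′ = 169`, while the factor 290 of 17 squared sends 29 to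
    -- `u′`.
    case-large-25 : ∀ {v′ u′ P S} → v ≡ 25 * v′ → f v ≡ 26 * f v′ →
      u ≡ P * u′ → f u ≡ S * f u′ → 5 ∤ u′ →
      (∀ {p n} → Prime p → p ∤ 5 → p ∣ P * n → p ∣ n) → 2 ∣ S →
      6 * P ≤ 5 * S → ⊥
    case-large-25 {v′} {u′} {P} {S} v≡ fv≡′ u≡ fu≡′ 5∤u′ P-power 2∣S lower = step₁₃ (local prime[13] 1≤u′ 13∣u′)
      where
      1≤v′ = cofactor-positive 25 1≤v v≡
      1≤u′ = ∤⇒positive 5∤u′
      8u≡ : 8 * u ≡ 130 * f v′
      8u≡ = trans (sym fv≡) (trans (cong (5 *_) fv≡′) (sym (*-assoc 5 26 (f v′))))
      4v≡ : 4 * v ≡ 5 * (S * f u′)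
      4v≡ = trans (sym fu≡) (cong (5 *_) fu≡′)
      13∣u′ : 13 ∣ u′
      13∣u′ = P-power prime[13] (from-no (13 ∣? 5)) (subst (13 ∣_) u≡
        (prime-∣-*ʳ 8 prime[13] (from-no (13 ∣? 8)) (subst (13 ∣_) (sym 8u≡) (∣-coefficient 130 (f v′)))))
      step₁₇ : ∀ {u″} → u′ ≡ 169 * u″ → 13 ∤ u″ → f u′ ≡ 170 * f u″ → Local 17 v′ → ⊥
      step₁₇ _ _ _ (large lower₁₇) = contradiction
        (over-budget {25} {32} {u} {v} {6 * 1} {5 * 1} {26 * 18} {25 * 17} 1≤u 1≤v product≡
          (scaled-bound 6 5 1 1 P S u′ u≡ fu≡′ lower (*-monoʳ-≤ 1 (≤f 1≤u′)))
          (scaled-bound 26 25 18 17 25 26 v′ v≡ fv≡′ ≤-refl lower₁₇))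
        (from-no (25 * (6 * 1 * (26 * 18)) ≤? 5 * 1 * (25 * 17) * 32))
      step₁₇ {u″} u′≡ 13∤u″ fu′≡ (square v″ v′≡ _ fv′≡)
        with f-even-cofactor (∤⇒positive 13∤u″) (odd-factor 169 (odd-factor P 2∤u u≡) u′≡)
      ... | inj₂ 2∣fu″ = 8∤4v (subst (8 ∣_) (sym 4v≡) (∣n⇒∣m*n 5 (*-pres-∣ 2∣S
              (subst (4 ∣_) (sym fu′≡) (*-pres-∣ {2} {170} {2} (divides-by 85 refl) 2∣fu″)))))
      ... | inj₁ refl = from-no (29 ∣? 169) (subst (29 ∣_) u′≡
              (P-power prime[29] (from-no (29 ∣? 5)) (subst (29 ∣_) u≡ (prime-∣-*ʳ 8 prime[29] (from-no (29 ∣? 8))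
                (subst (29 ∣_) (sym 8u≡) (∣n⇒∣m*n 130 (subst (29 ∣_) (sym fv′≡) (∣-coefficient 290 (f v″)))))))))
        where
        prime[29] : Prime 29
        prime[29] = from-yes (prime? 29)
      step₁₃ : Local 13 u′ → ⊥
      step₁₃ (large lower₁₃) = contradiction
        (over-budget {25} {32} {u} {v} {6 * 14} {5 * 13} {26 * 1} {25 * 1} 1≤u 1≤v product≡
          (scaled-bound 6 5 14 13 P S u′ u≡ fu≡′ lower lower₁₃)
          (scaled-bound 26 25 1 1 25 26 v′ v≡ fv≡′ ≤-refl (*-monoʳ-≤ 1 (≤f 1≤v′))))
        (from-no (25 * (6 * 14 * (26 * 1)) ≤? 5 * 13 * (25 * 1) * 32))
      step₁₃ (square u″ u′≡ 13∤u″ fu′≡) = step₁₇ {u″} u′≡ 13∤u″ fu′≡ (local prime[17] 1≤v′ 17∣v′)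
        where
        17∣v′ : 17 ∣ v′
        17∣v′ = prime-∣-*ʳ 25 prime[17] (from-no (17 ∣? 25)) (subst (17 ∣_) v≡
          (prime-∣-*ʳ 4 prime[17] (from-no (17 ∣? 4)) (subst (17 ∣_) (sym 4v≡)
            (∣n⇒∣m*n 5 (∣n⇒∣m*n S (subst (17 ∣_) (sym fu′≡) (∣-coefficient 170 (f u″))))))))

    -- Each factor 26 sends 13 to the other side, and `8 ∤ 4 * v` leaves `u′` a power of 13. If 13
    -- divides `v′` once, `f 13 = 14` sends 7 to `u′`; otherwise 169 divides `4 * v = 130 * f u′`,
    -- although 13 does not divide `f u′`.
    case-25-25 : ∀ {u′ v′} → u ≡ 25 * u′ → f u ≡ 26 * f u′ → v ≡ 25 * v′ → f v ≡ 26 * f v′ → ⊥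
    case-25-25 {u′} {v′} u≡ fu≡′ v≡ fv≡′ = parts (part-of prime[13] 1≤u′ 13∣u′) (part-of prime[13] 1≤v′ 13∣v′)
      where
      1≤u′ = cofactor-positive 25 1≤u u≡
      1≤v′ = cofactor-positive 25 1≤v v≡
      4v≡ : 4 * v ≡ 130 * f u′
      4v≡ = trans (sym fu≡) (trans (cong (5 *_) fu≡′) (sym (*-assoc 5 26 (f u′))))
      8u≡ : 8 * u ≡ 130 * f v′
      8u≡ = trans (sym fv≡) (trans (cong (5 *_) fv≡′) (sym (*-assoc 5 26 (f v′))))
      13∣u′ : 13 ∣ u′
      13∣u′ = prime-∣-*ʳ 25 prime[13] (from-no (13 ∣? 25)) (subst (13 ∣_) u≡
        (prime-∣-*ʳ 8 prime[13] (from-no (13 ∣? 8)) (subst (13 ∣_) (sym 8u≡) (∣-coefficient 130 (f v′)))))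
      13∣v′ : 13 ∣ v′
      13∣v′ = prime-∣-*ʳ 25 prime[13] (from-no (13 ∣? 25)) (subst (13 ∣_) v≡
        (prime-∣-*ʳ 4 prime[13] (from-no (13 ∣? 4)) (subst (13 ∣_) (sym 4v≡) (∣-coefficient 130 (f u′)))))
      169∣13^ : ∀ {k j} → Exponents k j → (k ≡ 0 × j ≡ 1) ⊎ 169 ∣ 13 ^ (k + j)
      169∣13^ {zero} odd-exponent  = inj₁ (refl , refl)
      169∣13^ {zero} even-exponent = inj₂ ∣-refl
      169∣13^ {suc k} {j} kj = inj₂ (subst (169 ∣_) (sym (^-distribˡ-+-* 13 (suc k) j))
        (*-pres-∣ (m∣m*n {13} (13 ^ k)) (13∣ kj)))
        where
        13∣ : ∀ {k j} → Exponents k j → 13 ∣ 13 ^ j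
        13∣ {k} odd-exponent  = m∣m*n (13 ^ k)
        13∣ {k} even-exponent = m∣m*n (13 ^ suc k)
      parts : Part 13 u′ → Part 13 v′ → ⊥
      parts (part {k} {j} kj u″ u′≡ 13∤u″ fu′≡) (part {k₂} {j₂} kj₂ v″ v′≡ 13∤v″ fv′≡)
        with f-even-cofactor (∤⇒positive 13∤u″) (odd-factor (13 ^ (k + j)) (odd-factor 25 2∤u u≡) u′≡)
      ... | inj₂ 2∣fu″ = 8∤4v (subst (8 ∣_) (sym 4v≡) (*-pres-∣ {2} {130} {4} (divides-by 65 refl)
              (subst (4 ∣_) (sym fu′≡)
              (*-pres-∣ (σ-local-even {13} k j (from-no (2 ∣? 13))) 2∣fu″))))
      ... | inj₁ refl with 169∣13^ kj₂
      ... | inj₁ (refl , refl) = from-no (7 ∣? 1) (prime-∣-^* (k + j) prime[7] (from-no (7 ∣? 13)) (subst (7 ∣_) u′≡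
              (prime-∣-*ʳ 25 prime[7] (from-no (7 ∣? 25)) (subst (7 ∣_) u≡ (prime-∣-*ʳ 8 prime[7] (from-no (7 ∣? 8))
                (subst (7 ∣_) (sym 8u≡) (∣n⇒∣m*n 130 (subst (7 ∣_) (sym fv′≡) (∣-coefficient 14 (f v″))))))))))
        where
        prime[7] : Prime 7
        prime[7] = from-yes (prime? 7)
      ... | inj₂ 169∣ = ∤-σ-local prime[13] kj (prime-∣-*ʳ 10 prime[13] (from-no (13 ∣? 10))
              (*-cancelˡ-∣ 13 (subst (169 ∣_) eq
              (∣n⇒∣m*n 4 (subst (169 ∣_) (sym v≡) (∣n⇒∣m*n 25 (subst (169 ∣_) (sym v′≡) (∣m⇒∣m*n v″ 169∣))))))))
        where
        S = σ-local 13 k j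
        eq : 4 * v ≡ 13 * (10 * S)
        eq = trans 4v≡ (trans (cong (130 *_) (trans fu′≡ (trans (cong (S *_) f-1) (*-identityʳ S)))) (*-assoc 13 10 S))

    combine : FivePart u → FivePart v → ⊥
    combine (twenty-five u′ u≡ fu≡′) (twenty-five v′ v≡ fv≡′) = case-25-25 {u′} {v′} u≡ fu≡′ v≡ fv≡′
    combine (twenty-five u′ u≡ fu≡′) (large-part P S v′ v≡ fv≡′ 5∤v′ P-power _ lower) =
      case-25-large {u′} {v′} {P} {S} u≡ fu≡′ v≡ fv≡′ 5∤v′ P-power lower
    combine (large-part P S u′ u≡ fu≡′ 5∤u′ P-power 2∣S lower) (twenty-five v′ v≡ fv≡′) =
      case-large-25 {v′} {u′} {P} {S} v≡ fv≡′ u≡ fu≡′ 5∤u′ P-power 2∣S lower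
    combine (large-part P S u′ u≡ fu≡′ 5∤u′ _ _ lower₁) (large-part Q R v′ v≡ fv≡′ 5∤v′ _ _ lower₂) = contradiction
      (over-budget {25} {32} {u} {v} {6 * 1} {5 * 1} {6 * 1} {5 * 1} 1≤u 1≤v product≡
        (scaled-bound 6 5 1 1 P S u′ u≡ fu≡′ lower₁ (*-monoʳ-≤ 1 (≤f (∤⇒positive 5∤u′))))
        (scaled-bound 6 5 1 1 Q R v′ v≡ fv≡′ lower₂ (*-monoʳ-≤ 1 (≤f (∤⇒positive 5∤v′)))))
      (from-no (25 * (6 * 1 * (6 * 1)) ≤? 5 * 1 * (5 * 1) * 32))

    5∣u : 5 ∣ u
    5∣u = prime-∣-*ʳ 8 prime[5] (from-no (5 ∣? 8)) (subst (5 ∣_) fv≡ (m∣m*n (f v)))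

    5∣v : 5 ∣ v
    5∣v = prime-∣-*ʳ 4 prime[5] (from-no (5 ∣? 4)) (subst (5 ∣_) fu≡ (m∣m*n (f u)))

    contradict : ⊥
    contradict = combine (five-part 1≤u 5∣u) (five-part 1≤v 5∣v)

  -- Splitting off the power of two; the odd case assembled

  record EvenPart (n : ℕ) : Set where
    constructor even-part
    field
      {C m}     : ℕ
      two-power-C : TwoPower C
      factors   : n ≡ C * m
      2∤m       : 2 ∤ m
      f-factors : f n ≡ f C * f m

  even-part-of : ∀ {n} → 1 ≤ n → 2 ∣ n → EvenPart n
  even-part-of {n} 1≤n 2∣n = build (prime-part prime[2] n 1≤n)
    where
    build : (∃₂ λ e m → n ≡ 2 ^ e * m × 2 ∤ m) → EvenPart n
    build (zero  , m , n≡ , 2∤m) = contradiction (subst (2 ∣_) (trans n≡ (*-identityˡ m)) 2∣n) 2∤m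
    build (suc e , m , n≡ , 2∤m) = even-part (two-power e) n≡ 2∤m (trans (cong f n≡)
      (f-* (m^n>0 2 (suc e)) (∤⇒positive 2∤m) (coprime-^ (suc e) (prime-∤⇒coprime prime[2] 2∤m))))

  odd-superperfect : ∀ {x} → 2 ∤ x → f (f x) ≡ 2 * x → x ≡ 9
  odd-superperfect {x} 2∤x ffx≡ = start (m≤n⇒m<n∨m≡n (∤⇒positive 2∤x))
    where
    cases : EvenPart (f x) → x ≡ 9
    cases (even-part {C} {M} (odd-power zero C≡ fC≡) fx≡ 2∤M ffx≡′) = exponent-one-case 2∤x 2∤M
      (trans (cong (_* f M) (sym fC≡)) (trans (sym ffx≡′) ffx≡)) (trans fx≡ (cong (_* M) C≡))
    cases (even-part {C} {M} (odd-power (suc g) C≡ fC≡) fx≡ 2∤M ffx≡′) =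
      ⊥-elim (odd-power-case {x} {M} {suc g} (∤⇒positive 2∤x) (∤⇒positive 2∤M) (s≤s z≤n)
        (trans (cong (_* f M) (sym fC≡)) (trans (sym ffx≡′) ffx≡)) (trans fx≡ (cong (_* M) C≡)))
    cases (even-part {C} {M} (even-power zero C≡ fC≡) fx≡ 2∤M ffx≡′) = ⊥-elim (exponent-two-case 2∤x 2∤M
      (trans (cong (_* f M) (sym fC≡)) (trans (sym ffx≡′) ffx≡)) (trans fx≡ (cong (_* M) C≡)))
    cases (even-part {C} {M} (even-power (suc g) C≡ fC≡) fx≡ 2∤M ffx≡′) =
      ⊥-elim (even-power-case {x} {M} {suc g} 2∤x 2∤M (s≤s z≤n)
        (trans (cong (_* f M) (sym fC≡)) (trans (sym ffx≡′) ffx≡)) (trans fx≡ (cong (_* M) C≡)))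
    start : 1 < x ⊎ 1 ≡ x → x ≡ 9
    start (inj₁ 1<x)  = cases (even-part-of (≤-trans (∤⇒positive 2∤x) (≤f (∤⇒positive 2∤x))) (f-even 1<x 2∤x))
    start (inj₂ 1≡x) = contradiction (begin
      1           ≡⟨ f-1 ⟨
      f 1         ≡⟨ cong f f-1 ⟨
      f (f 1)     ≡⟨ cong (f ∘ f) 1≡x ⟩
      f (f x)     ≡⟨ ffx≡ ⟩
      2 * x       ≡⟨ cong (2 *_) 1≡x ⟨
      2           ∎) λ ()
      where open ≡-Reasoning

  -- Even `x`: powers of two, and the sizes of the two 2-parts

  -- `y = t * (t + 2)` would have quotient exactly `(1 + t) * (1 + t) / y`, the value forbidden by
  -- any prime divisor of `t`; only `t = 1` escapes.
  odd-power-superperfect : ∀ g {y} → y ≡ (1 + 2 * g) * (3 + 2 * g) → f y ≡ 2 * (2 * ((1 + g) * (1 + g))) → g ≡ 0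
  odd-power-superperfect zero    _  _   = refl
  odd-power-superperfect (suc h) {y} y≡ fy≡ = contradiction (≤-reflexive (begin
      f y * (t * (2 + t))                            ≡⟨ cong₂ _*_ fy≡ (eq₁ h) ⟩
      2 * (2 * ((2 + h) * (2 + h))) * ((1 + 2 * suc h) * (3 + 2 * suc h))   ≡⟨ cong₂ _*_ (eq₂ h) (sym y≡) ⟩
      (1 + t) * (1 + t) * y                          ∎))
    (abundancy-odd-exponent {y} {t} (subst (1 ≤_) (sym y≡) (s≤s z≤n)) (s≤s (s≤s z≤n))
      (λ pp p∣t → ∣-trans p∣t (subst (t ∣_) (sym y≡) (m∣m*n (3 + 2 * suc h)))))
    where
    open ≡-Reasoning
    t = 1 + 2 * suc h
    eq₁ : ∀ h → (1 + 2 * (1 + h)) * (2 + (1 + 2 * (1 + h))) ≡ (1 + 2 * (1 + h)) * (3 + 2 * (1 + h))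
    eq₁ = solve-∀
    eq₂ : ∀ h → 2 * (2 * ((2 + h) * (2 + h))) ≡ (1 + (1 + 2 * (1 + h))) * (1 + (1 + 2 * (1 + h)))
    eq₂ = solve-∀

  -- `y = t * w` meets the abundancy bound with equality, so the prime `t` divides `y` exactly twice
  -- and hence divides `w = 2 * t + 3`. This means `t = 3` and `w = 9`, but 27 contains 3 three
  -- times. The case `t = 1` is `f 5 = 6`.
  even-power-not-superperfect : ∀ g {y} → y ≡ (1 + 2 * g) * (5 + 4 * g) → f y ≢ 2 * (4 * ((1 + g) * (1 + g)))
  even-power-not-superperfect zero {y} y≡ fy≡ = from-no (6 ≟ 8)
    (trans (sym (f-prime-power {k = 0} prime[5] odd-exponent)) (trans (cong f (sym y≡)) fy≡))
  even-power-not-superperfect (suc h) {y} y≡ fy≡ = conclude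
    (abundancy-even-exponent {y} {t} (subst (1 ≤_) (sym y≡) (s≤s z≤n)) (s≤s (s≤s z≤n))
      (λ pp p∣t → ∣-trans p∣t (subst (t ∣_) (sym y≡) (m∣m*n w))) (≤-reflexive (begin
      f y * (t * (3 + 2 * t))                        ≡⟨ cong₂ _*_ fy≡ (eq₁ h) ⟩
      2 * (4 * ((2 + h) * (2 + h))) * (t * w)        ≡⟨ cong₂ _*_ (eq₂ h) (sym y≡) ⟩
      2 * ((1 + t) * (1 + t)) * y                    ∎)))
    where
    open ≡-Reasoning
    t w : ℕ
    t = 1 + 2 * suc h
    w = 5 + 4 * suc h
    eq₁ : ∀ h → (1 + 2 * (1 + h)) * (3 + 2 * (1 + 2 * (1 + h))) ≡ (1 + 2 * (1 + h)) * (5 + 4 * (1 + h))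
    eq₁ = solve-∀
    eq₂ : ∀ h → 2 * (4 * ((2 + h) * (2 + h))) ≡ 2 * ((1 + (1 + 2 * (1 + h))) * (1 + (1 + 2 * (1 + h))))
    eq₂ = solve-∀
    w≡ : ∀ h → 5 + 4 * (1 + h) ≡ 3 + 2 * (1 + 2 * (1 + h))
    w≡ = solve-∀
    conclude : (Prime t × ∃ λ m → y ≡ t * t * m × t ∤ m × f y ≡ (1 + t * t) * f m) → ⊥
    conclude (pt , m , y≡ttm , t∤m , _) = impossible t m (prime-∣-3+2* pt t∣w′) w≡tm (w≡ h) t∤m
      where
      w≡tm : w ≡ t * m
      w≡tm = *-cancelˡ-≡ w (t * m) t (trans (sym y≡) (trans y≡ttm (*-assoc t t m)))
      t∣w′ : t ∣ 3 + 2 * t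
      t∣w′ = subst (t ∣_) (trans (sym w≡tm) (w≡ h)) (m∣m*n m)
      impossible : ∀ t m → t ≡ 3 → w ≡ t * m → w ≡ 3 + 2 * t → t ∤ m → ⊥
      impossible _ m refl w≡3m w≡9 3∤m = 3∤m (divides-by 1 (*-cancelˡ-≡ m 3 3 (trans (sym w≡3m) w≡9)))

  -- `27 / 16` is the quotient at 16. Paired with the `5 / 4` of the number 4 it gives `135 / 64`,
  -- barely above the permitted 2.
  data TwoPowerSize (C : ℕ) : Set where
    two   : C ≡ 2 → f C ≡ 3 → TwoPowerSize C
    four  : C ≡ 4 → f C ≡ 5 → TwoPowerSize C
    large : 27 * C ≤ 16 * f C → TwoPowerSize C

  two-power-size : ∀ {C} → TwoPower C → TwoPowerSize C
  two-power-size (odd-power  zero    C≡ fC≡) = two C≡ fC≡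
  two-power-size (even-power zero    C≡ fC≡) = four C≡ fC≡
  two-power-size (odd-power  (suc h) C≡ fC≡) = large (subst₂ (λ C F → 27 * C ≤ 16 * F) (sym C≡) (sym fC≡)
    (≤-trans (m≤m+n _ (24 + 40 * h + 10 * (h * h))) (≤-reflexive (eq h))))
    where
    eq : ∀ h → 27 * (2 * ((2 + h) * (2 + h))) + (24 + 40 * h + 10 * (h * h)) ≡
         16 * ((1 + 2 * (1 + h)) * (3 + 2 * (1 + h)))
    eq = solve-∀
  two-power-size (even-power (suc h) C≡ fC≡) = large (subst₂ (λ C F → 27 * C ≤ 16 * F) (sym C≡) (sym fC≡)
    (≤-trans (m≤m+n _ (48 * h + 20 * (h * h))) (≤-reflexive (eq h))))
    where
    eq : ∀ h → 27 * (4 * ((2 + h) * (2 + h))) + (48 * h + 20 * (h * h)) ≡ 16 * ((1 + 2 * (1 + h)) * (5 + 4 * (1 + h)))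
    eq = solve-∀

  -- The budget `16 / 15` is less than the `10 / 9` which the prime 3 costs at the least.
  two-four : ∀ {u v} → 1 ≤ u → 1 ≤ v → 3 ∣ v → 15 * (f u * f v) ≢ 16 * (u * v)
  two-four {u} {v} 1≤u 1≤v 3∣v eq = contradiction
    (over-budget {15} {16} {u} {v} {1} {1} {10} {9} 1≤u 1≤v eq (*-monoʳ-≤ 1 (≤f 1≤u)) (local-square prime[3] 1≤v 3∣v))
    (from-no (150 ≤? 144))

  -- In `h(C) h(u) h(D) h(v) = 2` the cofactors contribute at least 1 each, so `h(C) h(D) ≤ 2`.
  over-2-power : ∀ {α β γ δ A B C D u v} → 1 ≤ u → 1 ≤ v → 1 ≤ C → 1 ≤ D →
    A * f u ≡ D * v → B * f v ≡ 2 * (C * u) → α * C ≤ β * A → γ * D ≤ δ * B → α * γ ≤ β * δ * 2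
  over-2-power {α} {β} {γ} {δ} {A} {B} {C} {D} {u} {v} 1≤u 1≤v 1≤C 1≤D fx≡ fy≡ lower₁ lower₂ =
    *-cancelʳ-≤ (α * γ) (β * δ * 2) (C * D) {{>-nonZero (*-mono-≤ 1≤C 1≤D)}} (begin
      α * γ * (C * D)           ≤⟨ *-bounds {α} {β} {γ} {δ} lower₁ lower₂ ⟩
      β * δ * (A * B)           ≤⟨ *-monoʳ-≤ (β * δ) AB≤2CD ⟩
      β * δ * (2 * (C * D))     ≡⟨ *-assoc (β * δ) 2 (C * D) ⟨
      β * δ * 2 * (C * D)       ∎)
    where
    open ≤-Reasoning
    shuffle : ∀ C D u v → D * v * (2 * (C * u)) ≡ 2 * (C * D) * (u * v)
    shuffle = solve-∀
    AB≤2CD : A * B ≤ 2 * (C * D)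
    AB≤2CD = *-cancelʳ-≤ (A * B) (2 * (C * D)) (u * v) {{>-nonZero (*-mono-≤ 1≤u 1≤v)}} (begin
      A * B * (u * v)            ≤⟨ *-monoʳ-≤ (A * B) (*-mono-≤ (≤f 1≤u) (≤f 1≤v)) ⟩
      A * B * (f u * f v)        ≡⟨ interchange A B (f u) (f v) ⟩
      A * f u * (B * f v)        ≡⟨ cong₂ _*_ fx≡ fy≡ ⟩
      D * v * (2 * (C * u))      ≡⟨ shuffle C D u v ⟩
      2 * (C * D) * (u * v)      ∎)

  two-power-positive : ∀ {C} → TwoPower C → 1 ≤ C
  two-power-positive (odd-power  g C≡ _) = subst (1 ≤_) (sym C≡) (s≤s z≤n)
  two-power-positive (even-power g C≡ _) = subst (1 ≤_) (sym C≡) (s≤s z≤n)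

  both-even : ∀ {C D u v} → 2 ∤ u → 2 ∤ v → 1 ≤ C → 1 ≤ D → TwoPowerSize C → TwoPowerSize D →
              f C * f u ≡ D * v → f D * f v ≡ 2 * (C * u) → ⊥
  both-even {C} {D} {u} {v} 2∤u 2∤v 1≤C 1≤D C-size D-size fx≡ fy≡ = cases C-size D-size
    where
    1≤u = ∤⇒positive 2∤u
    1≤v = ∤⇒positive 2∤v
    bound : ∀ α β γ δ → α * C ≤ β * f C → γ * D ≤ δ * f D → α * γ ≤ β * δ * 2
    bound α β γ δ = over-2-power {α} {β} {γ} {δ} {f C} {f D} {C} {D} {u} {v} 1≤u 1≤v 1≤C 1≤D fx≡ fy≡
    2-bound : ∀ {C} → C ≡ 2 → f C ≡ 3 → 3 * C ≤ 2 * f C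
    2-bound C≡ fC≡ = ≤-reflexive (trans (cong (3 *_) C≡) (cong (2 *_) (sym fC≡)))
    4-bound : ∀ {C} → C ≡ 4 → f C ≡ 5 → 5 * C ≤ 4 * f C
    4-bound C≡ fC≡ = ≤-reflexive (trans (cong (5 *_) C≡) (cong (4 *_) (sym fC≡)))
    specialise : ∀ {A B c d} → f C ≡ A → f D ≡ B → C ≡ c → D ≡ d → A * f u ≡ d * v × B * f v ≡ 2 * c * u
    specialise refl refl refl refl = fx≡ , trans fy≡ (sym (*-assoc 2 C u))
    cases : TwoPowerSize C → TwoPowerSize D → ⊥
    cases (two C≡ fC≡) (two D≡ fD≡) =
      contradiction (bound 3 2 3 2 (2-bound C≡ fC≡) (2-bound D≡ fD≡)) (from-no (9 ≤? 8))
    cases (two C≡ fC≡) (large lower) =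
      contradiction (bound 3 2 27 16 (2-bound C≡ fC≡) lower) (from-no (81 ≤? 64))
    cases (four C≡ fC≡) (large lower) =
      contradiction (bound 5 4 27 16 (4-bound C≡ fC≡) lower) (from-no (135 ≤? 128))
    cases (large lower) (two D≡ fD≡) =
      contradiction (bound 27 16 3 2 lower (2-bound D≡ fD≡)) (from-no (81 ≤? 64))
    cases (large lower) (four D≡ fD≡) =
      contradiction (bound 27 16 5 4 lower (4-bound D≡ fD≡)) (from-no (135 ≤? 128))
    cases (large lower) (large lower′) =
      contradiction (bound 27 16 27 16 lower lower′) (from-no (729 ≤? 512))
    cases (four C≡ fC≡) (four D≡ fD≡) = let fu≡ , fv≡ = specialise fC≡ fD≡ C≡ D≡ in
      FourFour.contradict {u} {v} 2∤u 2∤v fu≡ fv≡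
    cases (two C≡ fC≡) (four D≡ fD≡) = let fu≡ , fv≡ = specialise fC≡ fD≡ C≡ D≡ in
      two-four {u} {v} 1≤u 1≤v (prime-∣-*ʳ 4 {v} prime[3] (from-no (3 ∣? 4)) (subst (3 ∣_) fu≡ (m∣m*n (f u))))
        (trans (interchange 3 5 (f u) (f v)) (trans (cong₂ _*_ fu≡ fv≡) (eq u v)))
      where
      eq : ∀ u v → 4 * v * (4 * u) ≡ 16 * (u * v)
      eq = solve-∀
    cases (four C≡ fC≡) (two D≡ fD≡) = let fu≡ , fv≡ = specialise fC≡ fD≡ C≡ D≡ in
      two-four {v} {u} 1≤v 1≤u (prime-∣-*ʳ 8 {u} prime[3] (from-no (3 ∣? 8)) (subst (3 ∣_) fv≡ (m∣m*n (f v))))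
        (trans (interchange 3 5 (f v) (f u)) (trans (cong₂ _*_ fv≡ fu≡) (eq u v)))
      where
      eq : ∀ u v → 8 * u * (2 * v) ≡ 16 * (v * u)
      eq = solve-∀

  even-superperfect : ∀ {x} → 1 ≤ x → 2 ∣ x → f (f x) ≡ 2 * x → x ≡ 2
  even-superperfect {x} 1≤x 2∣x ffx≡ = start (even-part-of 1≤x 2∣x)
    where
    start : EvenPart x → x ≡ 2
    start (even-part {C} {u} C-power x≡ 2∤u fx≡) = [ (λ u≡1 → pure C-power (x≡C u≡1)) , mixed ]′
      (f-even-cofactor (∤⇒positive 2∤u) 2∤u)
      where
      x≡C : u ≡ 1 → x ≡ C
      x≡C u≡1 = trans x≡ (trans (cong (C *_) u≡1) (*-identityʳ C))
      pure : TwoPower C → x ≡ C → x ≡ 2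
      pure (odd-power g C≡ fC≡) x≡C = trans x≡C (trans C≡ (cong (λ g → 2 * ((1 + g) * (1 + g)))
        (odd-power-superperfect g {f x} (trans (cong f x≡C) fC≡) (trans ffx≡ (cong (2 *_) (trans x≡C C≡))))))
      pure (even-power g C≡ fC≡) x≡C = contradiction (trans ffx≡ (cong (2 *_) (trans x≡C C≡)))
        (even-power-not-superperfect g {f x} (trans (cong f x≡C) fC≡))
      mixed : 2 ∣ f u → x ≡ 2
      mixed 2∣fu = ⊥-elim (finish (even-part-of (≤-trans 1≤x (≤f 1≤x)) (subst (2 ∣_) (sym fx≡) (∣n⇒∣m*n (f C) 2∣fu))))
        where
        finish : EvenPart (f x) → ⊥
        finish (even-part {D} {v} D-power fx≡Dv 2∤v ffx≡′) = both-even {C} {D} {u} {v} 2∤u 2∤v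
          (two-power-positive C-power) (two-power-positive D-power) (two-power-size C-power) (two-power-size D-power)
          (trans (sym fx≡) fx≡Dv) (trans (sym ffx≡′) (trans ffx≡ (cong (2 *_) x≡)))

  superperfect : ∀ {x} → 1 ≤ x → f (f x) ≡ 2 * x → x ≡ 2 ⊎ x ≡ 9
  superperfect {x} 1≤x ffx≡ = [ (λ 2∣x → inj₁ (even-superperfect 1≤x 2∣x ffx≡))
                               , (λ 2∤x → inj₂ (odd-superperfect 2∤x ffx≡)) ]′ (toSum (2 ∣? x))

theorem1 : (N : ℕ) → N ≥ 1 → (σ** (σ** N) ≡ 2 * N ⇔ (N ≡ 2 ⊎ N ≡ 9))
-- Both solutions are checked by evaluation: 2, 3, 4 and 9, 10, 18.
theorem1 N 1≤N = mk⇔ (superperfect 1≤N) λ { (inj₁ refl) → refl ; (inj₂ refl) → refl }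
  where open Superperfect σ** refl σ**-* σ**-prime-power
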